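{- Let $\mathcal{M}_1 = (V, \mathcal{I}_1)$ and $\mathcal{M}_2 = (V, \mathcal{I}_2)$ be two matroids on the same ground set $V$ with $|V| = n$, accessible only through rank oracles, and let $r$ be the maximum cardinality of a common independent set. For any $\varepsilon > 0$, there is a deterministic algorithm that finds a common independent set $S \in \mathcal{I}_1 \cap \mathcal{I}_2$ with $|S| \geq (2/3 - \varepsilon) r$, using $O(\frac{n}{\varepsilon})$ rank oracle queries.
   Context: A matroid $\mathcal{M} = (V,\mathcal{I})$ is given by a finite ground set $V$ and a nonempty family $\mathcal{I}\subseteq 2^V$ of independent sets satisfying the downward closure and augmentation properties. For $S\subseteq V$, $\mathrm{rank}_{\mathcal{M}}(S) = \max\{|T| : T\subseteq S, T\in\mathcal{I}\}$. A common independent set of $\mathcal{M}_1,\mathcal{M}_2$ is a set in $\mathcal{I}_1 \cap \mathcal{I}_2$. A rank oracle for $\mathcal{M}_i$ takes as input a subset $S \subseteq V$ and returns $\mathrm{rank}_{\mathcal{M}_i}(S)$; each such call counts as one query. -}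

module Defs where

open import Data.Nat using (ℕ; _<_; _≤_; _+_)
open import Data.Fin.Subset using (Subset; _⊆_; ∣_∣; _∈_; _∉_; _∪_; ⁅_⁆; ⊥)
open import Data.Product using (Σ; _×_; _,_; ∃)
open import Relation.Binary.PropositionalEquality using (_≡_)

record Matroid (n : ℕ) : Set₁ where
  field
    Indep         : Subset n → Set
    indep-∅       : Indep ⊥
    indep-down    : ∀ {A B} → A ⊆ B → Indep B → Indep A
    indep-augment : ∀ {A B} → Indep A → Indep B → ∣ A ∣ < ∣ B ∣ →
                    ∃ λ x → x ∈ B × x ∉ A × Indep (A ∪ ⁅ x ⁆)
open Matroid public

IsRankFunction : ∀ {n} → Matroid n → (Subset n → ℕ) → Set
IsRankFunction {n} M ρ = ∀ S →
  (Σ (Subset n) λ T → T ⊆ S × Indep M T × ∣ T ∣ ≡ ρ S) ×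
  (∀ T → T ⊆ S → Indep M T → ∣ T ∣ ≤ ρ S)

CommonIndep : ∀ {n} → Matroid n → Matroid n → Subset n → Set
CommonIndep M₁ M₂ S = Indep M₁ S × Indep M₂ S

IsMaxCommonSize : ∀ {n} → Matroid n → Matroid n → ℕ → Set
IsMaxCommonSize {n} M₁ M₂ r =
  (Σ (Subset n) λ S → CommonIndep M₁ M₂ S × ∣ S ∣ ≡ r) ×
  (∀ S → CommonIndep M₁ M₂ S → ∣ S ∣ ≤ r)

-- Deterministic rank-oracle algorithms on ground set Fin n, as decision trees:
-- at each step either stop with an output set, or ask a rank oracle
-- (of M₁ or of M₂) about a subset and continue depending on the answer.
data OracleAlg (n : ℕ) : Set where
  return  : Subset n → OracleAlg n
  askRank₁ : Subset n → (ℕ → OracleAlg n) → OracleAlg n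
  askRank₂ : Subset n → (ℕ → OracleAlg n) → OracleAlg n

output : ∀ {n} → OracleAlg n → (Subset n → ℕ) → (Subset n → ℕ) → Subset n
output (return S)     ρ₁ ρ₂ = S
output (askRank₁ S k) ρ₁ ρ₂ = output (k (ρ₁ S)) ρ₁ ρ₂
output (askRank₂ S k) ρ₁ ρ₂ = output (k (ρ₂ S)) ρ₁ ρ₂

queries : ∀ {n} → OracleAlg n → (Subset n → ℕ) → (Subset n → ℕ) → ℕ
queries (return S)     ρ₁ ρ₂ = 0
queries (askRank₁ S k) ρ₁ ρ₂ = 1 + queries (k (ρ₁ S)) ρ₁ ρ₂
queries (askRank₂ S k) ρ₁ ρ₂ = 1 + queries (k (ρ₂ S)) ρ₁ ρ₂

{-# OPTIONS --safe #-}

-- Fix a maximal common independent set S and consider augmenting by B₁ ∪ B₂ against the removal of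
-- A ⊆ S, where S + B₁ ∈ I₁, S − A + B₁ ∈ I₂, S − A + B₂ ∈ I₁ and S + B₂ ∈ I₂.  We keep S split as
-- A ∪ F ∪ R: F has not been touched yet, and R was moved into A and later returned to S for good.
-- A sweep grows B₁, moves elements of F into A until A matches B₁, grows B₂, and returns to S the
-- surplus X of A over B₂.  All tests are greedy, so a sweep costs O(n) queries, and since R only
-- grows, fewer than T sweeps have |X| > |S| / T.  After a sweep every element lies in
-- cl₁(S + B₁) or cl₂(R + B₁), and also in cl₁(F + B₂) or cl₂(S + B₂).  Adding the two resulting
-- upper bounds on r gives 2r ≤ 3(|S| + |B₂|) + |X|, while trimming A and B₁ to the size of B₂
-- gives a common independent set of size |S| + |B₂|.
module Submission where

open import Defs
open import Data.Nat using (ℕ; zero; suc; z≤n; s≤s; _≤?_; NonZero)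
import Data.Nat.DivMod as DivMod
import Data.Nat.Properties as ℕₚ
open import Data.Fin using (Fin; zero; suc)
open import Data.Fin.Subset using (Subset; ∣_∣; _⊆_; _∈_; _∉_; _∪_; _∩_; _─_; ⁅_⁆; ⊥; ⊤; inside; outside)
open import Data.Fin.Subset.Properties
open import Data.Nat.Coprimality using (Coprime)
open import Data.List using (List; []; _∷_; allFin; length)
open import Data.List.Properties using (length-tabulate)
open import Data.List.Relation.Unary.Any using (here; there)
import Data.List.Membership.Propositional as List
open import Data.List.Membership.Propositional.Properties using (∈-allFin)
open import Data.Vec using ([]; _∷_; here; there)
open import Data.Product using (Σ; ∃; _×_; _,_; proj₁; proj₂)
open import Data.Sum as Sum using (_⊎_; inj₁; inj₂; [_,_]′)
open import Function using (id; _∘_)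
open import Relation.Nullary using (¬_; Dec; yes; no; contradiction)
open import Relation.Nullary.Decidable using (_×-dec_)
open import Relation.Binary.PropositionalEquality using (_≡_; refl; sym; trans; cong; cong₂; subst)

module Matroids where

  open import Data.Fin.Subset using (_-_)
  open import Data.Nat using (_+_; _*_; _≤_; _<_; _/_)
  open import Data.Nat.Solver using (module +-*-Solver)
  open +-*-Solver using (solve; _:=_; _:+_; _:*_; con)

  private
    variable
      n : ℕ
      A B C D X Y Z : Subset n
      x y : Fin n

  -- Rank functions

  -- Opaque, so that unification can recover the two operands.
  infixl 6 _⊔_
  opaque
    _⊔_ : Subset n → Subset n → Subset n
    _⊔_ = _∪_

    ⊔⁻ : x ∈ A ⊔ B → x ∈ A ⊎ x ∈ B
    ⊔⁻ {A = A} {B = B} = x∈p∪q⁻ A B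

    ⊆-⊔ˡ : A ⊆ B → A ⊆ B ⊔ C
    ⊆-⊔ˡ f x∈ = x∈p∪q⁺ (inj₁ (f x∈))

    ⊆-⊔ʳ : A ⊆ C → A ⊆ B ⊔ C
    ⊆-⊔ʳ f x∈ = x∈p∪q⁺ (inj₂ (f x∈))

    ⊔⇒∪ : A ⊔ B ⊆ A ∪ B
    ⊔⇒∪ x∈ = x∈

  ⊔-lub : A ⊆ C → B ⊆ C → A ⊔ B ⊆ C
  ⊔-lub f g x∈ = [ f , g ]′ (⊔⁻ x∈)

  ⊔-mono : A ⊆ C → B ⊆ D → A ⊔ B ⊆ C ⊔ D
  ⊔-mono f g = ⊔-lub (⊆-⊔ˡ f) (⊆-⊔ʳ g)

  ⁅⁆⊆ : x ∈ A → ⁅ x ⁆ ⊆ A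
  ⁅⁆⊆ {x = x} {A = A} x∈A y∈ = subst (_∈ A) (sym (x∈⁅y⁆⇒x≡y x y∈)) x∈A

  ∣p∪q∣+∣p∩q∣ : ∀ (p q : Subset n) → ∣ p ∪ q ∣ + ∣ p ∩ q ∣ ≡ ∣ p ∣ + ∣ q ∣
  ∣p∪q∣+∣p∩q∣ [] [] = refl
  ∣p∪q∣+∣p∩q∣ (inside ∷ p) (inside ∷ q) =
    cong suc (trans (ℕₚ.+-suc _ _) (trans (cong suc (∣p∪q∣+∣p∩q∣ p q)) (sym (ℕₚ.+-suc _ _))))
  ∣p∪q∣+∣p∩q∣ (inside ∷ p) (outside ∷ q) = cong suc (∣p∪q∣+∣p∩q∣ p q)
  ∣p∪q∣+∣p∩q∣ (outside ∷ p) (inside ∷ q) = trans (cong suc (∣p∪q∣+∣p∩q∣ p q)) (sym (ℕₚ.+-suc _ _))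
  ∣p∪q∣+∣p∩q∣ (outside ∷ p) (outside ∷ q) = ∣p∪q∣+∣p∩q∣ p q

  ∣∣-submodular : X ⊆ A ⊔ B → Y ⊆ A → Y ⊆ B → ∣ X ∣ + ∣ Y ∣ ≤ ∣ A ∣ + ∣ B ∣
  ∣∣-submodular {X = X} {A = A} {B = B} {Y = Y} X⊆ Y⊆A Y⊆B = subst (∣ X ∣ + ∣ Y ∣ ≤_) (∣p∪q∣+∣p∩q∣ A B)
    (ℕₚ.+-mono-≤ (p⊆q⇒∣p∣≤∣q∣ (λ x∈ → ⊔⇒∪ (X⊆ x∈))) (p⊆q⇒∣p∣≤∣q∣ (λ x∈ → x∈p∩q⁺ (Y⊆A x∈ , Y⊆B x∈))))

  ∣⊔∣≤ : (A B : Subset n) → ∣ A ⊔ B ∣ ≤ ∣ A ∣ + ∣ B ∣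
  ∣⊔∣≤ A B = ℕₚ.≤-trans (ℕₚ.m≤m+n _ _) (∣∣-submodular {Y = ⊥} ⊆-refl ⊥⊆ ⊥⊆)

  p─q∌q : ∀ (p q : Subset n) {x} → x ∈ p ─ q → x ∉ q
  p─q∌q (inside ∷ p) (outside ∷ q) here ()
  p─q∌q (_ ∷ p) (_ ∷ q) (there x∈) (there x∈q) = p─q∌q p q x∈ x∈q

  ∣─∣+∣∣≤ : {A B : Subset n} → A ⊆ B → ∣ B ─ A ∣ + ∣ A ∣ ≤ ∣ B ∣
  ∣─∣+∣∣≤ {n} {A} {B} A⊆B = begin
    ∣ B ─ A ∣ + ∣ A ∣                     ≡⟨ ∣p∪q∣+∣p∩q∣ (B ─ A) A ⟨
    ∣ (B ─ A) ∪ A ∣ + ∣ (B ─ A) ∩ A ∣     ≤⟨ ℕₚ.+-mono-≤ (p⊆q⇒∣p∣≤∣q∣ union) (p⊆q⇒∣p∣≤∣q∣ inter) ⟩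
    ∣ B ∣ + ∣ ⊥ {n} ∣                     ≡⟨ cong (∣ B ∣ +_) (∣⊥∣≡0 n) ⟩
    ∣ B ∣ + 0                             ≡⟨ ℕₚ.+-identityʳ _ ⟩
    ∣ B ∣                                 ∎
    where
    open ℕₚ.≤-Reasoning
    union : (B ─ A) ∪ A ⊆ B
    union x∈ = [ p─q⊆p B A , A⊆B ]′ (x∈p∪q⁻ (B ─ A) A x∈)
    inter : (B ─ A) ∩ A ⊆ ⊥
    inter x∈ = let x∈─ , x∈A = x∈p∩q⁻ (B ─ A) A x∈ in contradiction x∈A (p─q∌q B A x∈─)

  A⊆B⊔A─B : (A B : Subset n) → A ⊆ B ⊔ (A ─ B)
  A⊆B⊔A─B A B {x} x∈A with x ∈? B
  ... | yes x∈B = ⊆-⊔ˡ ⊆-refl x∈B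
  ... | no  x∉B = ⊆-⊔ʳ ⊆-refl (x∈p∧x∉q⇒x∈p─q x∈A x∉B)

  ∣∣-suc : x ∉ A → ∣ A ⊔ ⁅ x ⁆ ∣ ≡ suc ∣ A ∣
  ∣∣-suc {x = x} {A = A} x∉A = ℕₚ.≤-antisym
    (ℕₚ.≤-trans (∣⊔∣≤ A ⁅ x ⁆) (ℕₚ.≤-reflexive (trans (cong (∣ A ∣ +_) (∣⁅x⁆∣≡1 x)) (ℕₚ.+-comm _ 1))))
    (p⊂q⇒∣p∣<∣q∣ (⊆-⊔ˡ ⊆-refl , x , ⊆-⊔ʳ ⊆-refl (x∈⁅x⁆ x) , x∉A))

  ⊆∧∣∣≥⇒⊇ : A ⊆ B → ∣ B ∣ ≤ ∣ A ∣ → B ⊆ A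
  ⊆∧∣∣≥⇒⊇ {A = A} A⊆B ∣B∣≤∣A∣ {x} x∈B with x ∈? A
  ... | yes x∈A = x∈A
  ... | no  x∉A = contradiction ∣B∣≤∣A∣ (ℕₚ.<⇒≱ (p⊂q⇒∣p∣<∣q∣ (A⊆B , x , x∈B , x∉A)))

  record IsMatroidRank (ρ : Subset n → ℕ) : Set where
    field
      bounded : ∀ S → ρ S ≤ ∣ S ∣
      mono    : A ⊆ B → ρ A ≤ ρ B
      submod  : ∀ C → A ⊆ B → ρ (B ⊔ C) + ρ A ≤ ρ (A ⊔ C) + ρ B

    infix 4 _∈cl_
    _∈cl_ : Fin n → Subset n → Set
    x ∈cl A = ρ (A ⊔ ⁅ x ⁆) ≤ ρ A

    ∈⇒∈cl : x ∈ A → x ∈cl A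
    ∈⇒∈cl x∈A = mono (⊔-lub ⊆-refl (⁅⁆⊆ x∈A))

    cl-mono : A ⊆ B → x ∈cl A → x ∈cl B
    cl-mono {A = A} {B = B} {x = x} A⊆B x∈ = ℕₚ.+-cancelʳ-≤ (ρ A) _ _ (begin
      ρ (B ⊔ ⁅ x ⁆) + ρ A   ≤⟨ submod ⁅ x ⁆ A⊆B ⟩
      ρ (A ⊔ ⁅ x ⁆) + ρ B   ≤⟨ ℕₚ.+-monoˡ-≤ (ρ B) x∈ ⟩
      ρ A + ρ B             ≡⟨ ℕₚ.+-comm (ρ A) _ ⟩
      ρ B + ρ A             ∎)
      where open ℕₚ.≤-Reasoning

    subadd : ∀ B C → ρ (B ⊔ C) ≤ ρ B + ∣ C ∣
    subadd B C = begin
      ρ (B ⊔ C)         ≤⟨ ℕₚ.m≤m+n _ (ρ ⊥) ⟩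
      ρ (B ⊔ C) + ρ ⊥   ≤⟨ submod C ⊥⊆ ⟩
      ρ (⊥ ⊔ C) + ρ B   ≤⟨ ℕₚ.+-monoˡ-≤ (ρ B) (ℕₚ.≤-trans (mono (⊔-lub ⊥⊆ ⊆-refl)) (bounded C)) ⟩
      ∣ C ∣ + ρ B       ≡⟨ ℕₚ.+-comm ∣ C ∣ _ ⟩
      ρ B + ∣ C ∣       ∎
      where open ℕₚ.≤-Reasoning

    -- The elements of `B` are adjoined one at a time; by `cl-mono` each stays in the closure of `A`
    -- with the others, so no step raises the rank.
    spans : (∀ {x} → x ∈ B → x ∈cl A) → ρ (A ⊔ B) ≤ ρ A
    spans {B = B} {A = A} = go ∣ B ∣ B ℕₚ.≤-refl
      where
      open ℕₚ.≤-Reasoning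
      go : ∀ k B → ∣ B ∣ ≤ k → (∀ {x} → x ∈ B → x ∈cl A) → ρ (A ⊔ B) ≤ ρ A
      go k B ∣B∣≤k B⊆ with nonempty? B
      ... | no empty = mono (⊔-lub ⊆-refl (λ x∈ → contradiction (_ , x∈) empty))
      go zero B ∣B∣≤k B⊆ | yes (x , x∈B) =
        contradiction (ℕₚ.≤-trans (x∈p⇒∣p-x∣<∣p∣ x∈B) ∣B∣≤k) λ ()
      go (suc k) B ∣B∣≤k B⊆ | yes (x , x∈B) = begin
        ρ (A ⊔ B)                   ≤⟨ mono (⊔-lub (⊆-⊔ˡ (⊆-⊔ˡ ⊆-refl)) B⊆′) ⟩
        ρ (A ⊔ (B - x) ⊔ ⁅ x ⁆)     ≤⟨ cl-mono (⊆-⊔ˡ ⊆-refl) (B⊆ x∈B) ⟩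
        ρ (A ⊔ (B - x))
          ≤⟨ go k (B - x) (ℕₚ.≤-pred (ℕₚ.≤-trans (x∈p⇒∣p-x∣<∣p∣ x∈B) ∣B∣≤k)) (λ y∈ → B⊆ (p─q⊆p B ⁅ x ⁆ y∈)) ⟩
        ρ A                         ∎
        where
        B⊆′ : B ⊆ A ⊔ (B - x) ⊔ ⁅ x ⁆
        B⊆′ y∈ = ⊔-lub (⊆-⊔ʳ ⊆-refl) (⊆-⊔ˡ (⊆-⊔ʳ ⊆-refl)) (A⊆B⊔A─B B ⁅ x ⁆ y∈)

    spans-⊆ : Y ⊆ A ⊔ B → (∀ {x} → x ∈ B → x ∈cl A) → ρ Y ≤ ρ A
    spans-⊆ Y⊆ B⊆ = ℕₚ.≤-trans (mono Y⊆) (spans B⊆)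

    cl-trans : (∀ {x} → x ∈ A → x ∈cl B) → x ∈cl A → x ∈cl B
    cl-trans {A = A} {B = B} {x = x} A⊆ x∈ = begin
      ρ (B ⊔ ⁅ x ⁆)       ≤⟨ mono (⊔-mono (⊆-⊔ˡ ⊆-refl) ⊆-refl) ⟩
      ρ (B ⊔ A ⊔ ⁅ x ⁆)   ≤⟨ cl-mono (⊆-⊔ʳ ⊆-refl) x∈ ⟩
      ρ (B ⊔ A)           ≤⟨ spans A⊆ ⟩
      ρ B                 ∎
      where open ℕₚ.≤-Reasoning

    lipschitz : ∀ C → X ⊆ Y → ρ (C ⊔ Y) + ∣ X ∣ ≤ ρ (C ⊔ X) + ∣ Y ∣
    lipschitz {X = X} {Y = Y} C X⊆Y = begin
      ρ (C ⊔ Y) + ∣ X ∣                     ≤⟨ ℕₚ.+-monoˡ-≤ _ (mono (⊔-lub (⊆-⊔ˡ (⊆-⊔ˡ ⊆-refl)) Y⊆)) ⟩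
      ρ (C ⊔ X ⊔ (Y ─ X)) + ∣ X ∣           ≤⟨ ℕₚ.+-monoˡ-≤ _ (subadd (C ⊔ X) (Y ─ X)) ⟩
      ρ (C ⊔ X) + ∣ Y ─ X ∣ + ∣ X ∣         ≡⟨ ℕₚ.+-assoc (ρ (C ⊔ X)) _ _ ⟩
      ρ (C ⊔ X) + (∣ Y ─ X ∣ + ∣ X ∣)       ≤⟨ ℕₚ.+-monoʳ-≤ (ρ (C ⊔ X)) (∣─∣+∣∣≤ X⊆Y) ⟩
      ρ (C ⊔ X) + ∣ Y ∣                     ∎
      where
      open ℕₚ.≤-Reasoning
      Y⊆ : Y ⊆ C ⊔ X ⊔ (Y ─ X)
      Y⊆ y∈ = ⊔-mono (⊆-⊔ʳ ⊆-refl) ⊆-refl (A⊆B⊔A─B Y X y∈)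

    -- Passing from `Y` to `X` lowers the rank by no more than it lowers the cardinality. The number
    -- `k` is left general because `C` is often a union whose parts are counted separately.
    free-⊆ : ∀ {k} → X ⊆ Y → k + ∣ Y ∣ ≤ ρ (C ⊔ Y) → k + ∣ X ∣ ≤ ρ (C ⊔ X)
    free-⊆ {X = X} {Y = Y} {C = C} {k = k} X⊆Y free = ℕₚ.+-cancelʳ-≤ ∣ Y ∣ _ _ (begin
      k + ∣ X ∣ + ∣ Y ∣      ≡⟨ solve 3 (λ a b c → a :+ b :+ c := a :+ c :+ b) refl k ∣ X ∣ ∣ Y ∣ ⟩
      k + ∣ Y ∣ + ∣ X ∣      ≤⟨ ℕₚ.+-monoˡ-≤ ∣ X ∣ free ⟩
      ρ (C ⊔ Y) + ∣ X ∣      ≤⟨ lipschitz C X⊆Y ⟩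
      ρ (C ⊔ X) + ∣ Y ∣      ∎)
      where open ℕₚ.≤-Reasoning

    indep-⊆ : X ⊆ Y → ∣ Y ∣ ≤ ρ Y → ∣ X ∣ ≤ ρ X
    indep-⊆ X⊆Y indep = ℕₚ.≤-trans (free-⊆ {C = ⊥} {k = 0} X⊆Y (ℕₚ.≤-trans indep (mono (⊆-⊔ʳ ⊆-refl)))) (mono (⊔-lub ⊥⊆ ⊆-refl))

    free⇒indep : ∣ A ∣ + ∣ B ∣ ≤ ρ (A ⊔ B) → ∣ A ⊔ B ∣ ≤ ρ (A ⊔ B)
    free⇒indep {A = A} {B = B} = ℕₚ.≤-trans (∣⊔∣≤ A B)

    free⇒∉cl : ∣ C ∣ + ∣ X ∣ ≤ ρ (C ⊔ X) → x ∈ X → ¬ x ∈cl C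
    free⇒∉cl {C = C} {X = X} {x = x} free x∈X x∈cl = ℕₚ.<-irrefl refl (begin-strict
      ∣ C ∣               <⟨ ℕₚ.m<m+n ∣ C ∣ (ℕₚ.≤-reflexive (sym (∣⁅x⁆∣≡1 x))) ⟩
      ∣ C ∣ + ∣ ⁅ x ⁆ ∣   ≤⟨ free-⊆ (⁅⁆⊆ x∈X) free ⟩
      ρ (C ⊔ ⁅ x ⁆)       ≤⟨ x∈cl ⟩
      ρ C                 ≤⟨ bounded C ⟩
      ∣ C ∣               ∎)
      where open ℕₚ.≤-Reasoning

    free-restrict : ∀ {k} → k + ∣ B ∣ ≤ ρ (A ⊔ B) → k ≤ ρ A
    free-restrict {B = B} {A = A} free = ℕₚ.+-cancelʳ-≤ ∣ B ∣ _ _ (ℕₚ.≤-trans free (subadd A B))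

    -- Contracting the span of Z leaves Y independent, so Y cannot help X ⊆ cl Z to span x ∈ cl Z.
    cl-cancel : (∀ {y} → y ∈ X → y ∈cl Z) → x ∈cl Z → ρ Z + ∣ Y ∣ ≤ ρ (Z ⊔ Y) → x ∈cl Y ⊔ X → x ∈cl X
    cl-cancel {X = X} {Z = Z} {x = x} {Y = Y} X⊆ x∈Z free x∈ = ℕₚ.+-cancelˡ-≤ (ρ Z + ∣ Y ∣) _ _ (begin
      ρ Z + ∣ Y ∣ + ρ (X ⊔ ⁅ x ⁆)                   ≤⟨ ℕₚ.+-monoˡ-≤ _ free ⟩
      ρ (Z ⊔ Y) + ρ (X ⊔ ⁅ x ⁆)                     ≤⟨ ℕₚ.+-monoˡ-≤ _ (mono (⊔-mono (⊆-⊔ˡ ⊆-refl) ⊆-refl)) ⟩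
      ρ (Z ⊔ (X ⊔ ⁅ x ⁆) ⊔ Y) + ρ (X ⊔ ⁅ x ⁆)       ≤⟨ submod Y (⊆-⊔ʳ ⊆-refl) ⟩
      ρ (X ⊔ ⁅ x ⁆ ⊔ Y) + ρ (Z ⊔ (X ⊔ ⁅ x ⁆))       ≤⟨ ℕₚ.+-mono-≤ left (spans X⁺⊆) ⟩
      ρ X + ∣ Y ∣ + ρ Z
        ≡⟨ solve 3 (λ a b c → a :+ b :+ c := c :+ b :+ a) refl (ρ X) ∣ Y ∣ (ρ Z) ⟩
      ρ Z + ∣ Y ∣ + ρ X                             ∎)
      where
      open ℕₚ.≤-Reasoning
      X⁺⊆ : ∀ {y} → y ∈ X ⊔ ⁅ x ⁆ → y ∈cl Z
      X⁺⊆ y∈ = [ X⊆ , (λ y∈x → subst (_∈cl Z) (sym (x∈⁅y⁆⇒x≡y x y∈x)) x∈Z) ]′ (⊔⁻ y∈)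
      left : ρ (X ⊔ ⁅ x ⁆ ⊔ Y) ≤ ρ X + ∣ Y ∣
      left = begin
        ρ (X ⊔ ⁅ x ⁆ ⊔ Y)   ≤⟨ mono (⊔-lub (⊔-mono (⊆-⊔ʳ ⊆-refl) ⊆-refl) (⊆-⊔ˡ (⊆-⊔ˡ ⊆-refl))) ⟩
        ρ (Y ⊔ X ⊔ ⁅ x ⁆)   ≤⟨ x∈ ⟩
        ρ (Y ⊔ X)           ≤⟨ mono (⊔-lub (⊆-⊔ʳ ⊆-refl) (⊆-⊔ˡ ⊆-refl)) ⟩
        ρ (X ⊔ Y)           ≤⟨ subadd X Y ⟩
        ρ X + ∣ Y ∣         ∎

    -- K ∪ P is a basis of cl S, so elements that are free over S stay free over K ∪ P.
    exchange-basis : ∀ {K P Q S} {k} → K ⊆ S → (∀ {x} → x ∈ P → x ∈cl S) → (∀ {x} → x ∈ S → x ∈cl K ⊔ P) →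
                     k + ∣ P ∣ ≤ ρ (K ⊔ P) → ∣ S ∣ + ∣ Q ∣ ≤ ρ (S ⊔ Q) → k + ∣ P ∣ + ∣ Q ∣ ≤ ρ (K ⊔ P ⊔ Q)
    exchange-basis {K} {P} {Q} {S} {k} K⊆S P⊆ S⊆ freeP freeQ = begin
      k + ∣ P ∣ + ∣ Q ∣   ≤⟨ ℕₚ.+-monoˡ-≤ ∣ Q ∣ (begin
        k + ∣ P ∣           ≤⟨ freeP ⟩
        ρ (K ⊔ P)           ≤⟨ spans-⊆ (⊔-mono K⊆S ⊆-refl) P⊆ ⟩
        ρ S                 ≤⟨ bounded S ⟩
        ∣ S ∣               ∎) ⟩
      ∣ S ∣ + ∣ Q ∣       ≤⟨ freeQ ⟩
      ρ (S ⊔ Q)           ≤⟨ spans-⊆ (⊔-lub (⊆-⊔ʳ ⊆-refl) (⊆-⊔ˡ (⊆-⊔ʳ ⊆-refl))) (λ x∈ → cl-mono (⊆-⊔ˡ ⊆-refl) (S⊆ x∈)) ⟩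
      ρ (K ⊔ P ⊔ Q)       ∎
      where open ℕₚ.≤-Reasoning

  -- The rank function of a matroid

  module _ (M : Matroid n) {ρ : Subset n → ℕ} (isRank : IsRankFunction M ρ) where

    ≤rank⇒indep : ∣ A ∣ ≤ ρ A → Indep M A
    ≤rank⇒indep {A = A} ∣A∣≤ with proj₁ (isRank A)
    ... | T , T⊆A , indep , ∣T∣≡ = indep-down M (⊆∧∣∣≥⇒⊇ T⊆A (subst (∣ A ∣ ≤_) (sym ∣T∣≡) ∣A∣≤)) indep

    indep⇒≤rank : Indep M A → ∣ A ∣ ≤ ρ A
    indep⇒≤rank {A = A} = proj₂ (isRank A) A ⊆-refl

    -- Augmentation always draws from the set `T` that attains `ρ A`, so the growing set never
    -- leaves `A`; `k` bounds the number of elements still missing.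
    extend-to-basis : ∀ {I} → Indep M I → I ⊆ A → ∃ λ J → I ⊆ J × J ⊆ A × Indep M J × ρ A ≤ ∣ J ∣
    extend-to-basis {A = A} {I₀} indep₀ I₀⊆A with proj₁ (isRank A)
    ... | T , T⊆A , indepT , ∣T∣≡ = go (ρ A) indep₀ I₀⊆A (ℕₚ.m≤m+n _ _)
      where
      go : ∀ k {I} → Indep M I → I ⊆ A → ρ A ≤ k + ∣ I ∣ → ∃ λ J → I ⊆ J × J ⊆ A × Indep M J × ρ A ≤ ∣ J ∣
      go k {I} indep I⊆A ≤k with ρ A ≤? ∣ I ∣
      ... | yes ≤I = I , ⊆-refl , I⊆A , indep , ≤I
      go zero indep I⊆A ≤k | no ≰I = contradiction ≤k ≰I
      go (suc k) {I} indep I⊆A ≤k | no ≰I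
        with indep-augment M indep indepT (subst (∣ I ∣ <_) (sym ∣T∣≡) (ℕₚ.≰⇒> ≰I))
      ... | x , x∈T , x∉I , indep′
        with go k (indep-down M ⊔⇒∪ indep′) (⊔-lub I⊆A (⁅⁆⊆ (T⊆A x∈T)))
               (subst (ρ A ≤_) (trans (sym (ℕₚ.+-suc k _)) (cong (k +_) (sym (∣∣-suc x∉I)))) ≤k)
      ... | J , I⊆J , rest = J , (λ y∈ → I⊆J (⊆-⊔ˡ ⊆-refl y∈)) , rest

    isMatroidRank : IsMatroidRank ρ
    isMatroidRank .IsMatroidRank.bounded S with proj₁ (isRank S)
    ... | T , T⊆S , _ , ∣T∣≡ = subst (_≤ ∣ S ∣) ∣T∣≡ (p⊆q⇒∣p∣≤∣q∣ T⊆S)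
    isMatroidRank .IsMatroidRank.mono {A = A} {B = B} A⊆B with proj₁ (isRank A)
    ... | T , T⊆A , indep , ∣T∣≡ = subst (_≤ ρ B) ∣T∣≡ (proj₂ (isRank B) T (λ x∈ → A⊆B (T⊆A x∈)) indep)
    -- With I ⊆ K bases of A ⊆ B ∪ C, count K by its parts inside A ∪ C and inside B, which both contain I.
    isMatroidRank .IsMatroidRank.submod {A = A} {B = B} C A⊆B with proj₁ (isRank A)
    ... | I , I⊆A , indepI , ∣I∣≡ with extend-to-basis indepI (λ x∈ → ⊆-⊔ˡ {C = C} A⊆B (I⊆A x∈))
    ... | K , I⊆K , K⊆ , indepK , ≤K = begin
      ρ (B ⊔ C) + ρ A                 ≤⟨ ℕₚ.+-mono-≤ ≤K (ℕₚ.≤-reflexive (sym ∣I∣≡)) ⟩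
      ∣ K ∣ + ∣ I ∣
        ≤⟨ ∣∣-submodular K⊆′ (λ x∈ → x∈p∩q⁺ (I⊆K x∈ , ⊆-⊔ˡ I⊆A x∈)) (λ x∈ → x∈p∩q⁺ (I⊆K x∈ , A⊆B (I⊆A x∈))) ⟩
      ∣ K ∩ (A ⊔ C) ∣ + ∣ K ∩ B ∣     ≤⟨ ℕₚ.+-mono-≤ (part (A ⊔ C)) (part B) ⟩
      ρ (A ⊔ C) + ρ B                 ∎
      where
      open ℕₚ.≤-Reasoning
      part : ∀ S → ∣ K ∩ S ∣ ≤ ρ S
      part S = proj₂ (isRank S) (K ∩ S) (p∩q⊆q K S) (indep-down M (p∩q⊆p K S) indepK)
      K⊆′ : K ⊆ K ∩ (A ⊔ C) ⊔ K ∩ B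
      K⊆′ x∈K = [ (λ x∈B → ⊆-⊔ʳ ⊆-refl (x∈p∩q⁺ (x∈K , x∈B)))
                , (λ x∈C → ⊆-⊔ˡ ⊆-refl (x∈p∩q⁺ (x∈K , ⊆-⊔ʳ ⊆-refl x∈C))) ]′ (⊔⁻ (K⊆ x∈K))

  -- Oracle algorithms

  -- A finite choice: the cover in `dual-bound` comes as one disjunction per element, and this
  -- gathers the left cases into an actual subset.
  split : {P Q : Fin n → Set} → (∀ v → P v ⊎ Q v) →
          ∃ λ S → (∀ {v} → v ∈ S → P v) × (∀ {v} → v ∉ S → Q v)
  split {n = zero} f = [] , (λ { {()} }) , λ { {()} }
  split {n = suc n} f with split (f ∘ suc) | f zero
  ... | S , S⇒P , S̸⇒Q | inj₁ p = inside ∷ S , (λ { here → p ; (there v∈) → S⇒P v∈ }) ,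
    λ { {zero} v∉ → contradiction here v∉ ; {suc v} v∉ → S̸⇒Q (v∉ ∘ there) }
  ... | S , S⇒P , S̸⇒Q | inj₂ q = outside ∷ S , (λ { (there v∈) → S⇒P v∈ }) ,
    λ { {zero} v∉ → q ; {suc v} v∉ → S̸⇒Q (v∉ ∘ there) }

  data Side : Set where
    first second : Side

  ask : Side → Subset n → (ℕ → OracleAlg n) → OracleAlg n
  ask first  = askRank₁
  ask second = askRank₂

  select : {P : Set} {E : Set} → Dec P → E → E → E
  select (yes _) x y = x
  select (no _)  x y = y

  -- A test (i , C) admits X when X is disjoint from C and C ∪ X is independent in matroid i.
  Test : ℕ → Set
  Test n = Side × Subset n

  -- The result goes to a continuation, so passes chain without a bind on decision trees. Both tests
  -- are queried for every `v`, even outside `Y`, which makes the cost exactly two queries per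
  -- element.
  grow : Test n → Test n → Subset n → List (Fin n) → Subset n → (Subset n → OracleAlg n) → OracleAlg n
  grow t u Y [] X k = k X
  grow t@(i , C) u@(j , D) Y (v ∷ vs) X k =
    ask i (C ⊔ (X ⊔ ⁅ v ⁆)) λ a → ask j (D ⊔ (X ⊔ ⁅ v ⁆)) λ b →
    grow t u Y vs
      (select (v ∈? Y ×-dec ∣ C ∣ + ∣ X ⊔ ⁅ v ⁆ ∣ ≤? a ×-dec ∣ D ∣ + ∣ X ⊔ ⁅ v ⁆ ∣ ≤? b) (X ⊔ ⁅ v ⁆) X) k

  greedy₂ : Test n → Test n → Subset n → Subset n → (Subset n → OracleAlg n) → OracleAlg n
  greedy₂ t u Y X k = grow t u Y (allFin _) X k

  -- The test is doubled to reuse `greedy₂`; this costs only a constant factor.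
  greedy₁ : Test n → Subset n → (Subset n → OracleAlg n) → OracleAlg n
  greedy₁ t Y k = greedy₂ t t Y ⊥ k

  -- Weak duality and the guarantees of the greedy passes

  module Intersection (M₁ M₂ : Matroid n) {ρ₁ ρ₂ : Subset n → ℕ}
                      (isRank₁ : IsRankFunction M₁ ρ₁) (isRank₂ : IsRankFunction M₂ ρ₂) where

    rank : Side → Subset n → ℕ
    rank first  = ρ₁
    rank second = ρ₂

    isRank : ∀ i → IsMatroidRank (rank i)
    isRank first  = isMatroidRank M₁ isRank₁
    isRank second = isMatroidRank M₂ isRank₂

    module R i = IsMatroidRank (isRank i)
    open R public renaming (_∈cl_ to Closed)

    infix 4 _∈cl₁_ _∈cl₂_
    _∈cl₁_ _∈cl₂_ : Fin n → Subset n → Set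
    x ∈cl₁ A = Closed first x A
    x ∈cl₂ A = Closed second x A

    -- Weak duality of matroid intersection: `X` splits into a part spanned by `A` in the first
    -- matroid and a part spanned by `B` in the second, and each part is at most the rank of what
    -- spans it.
    dual-bound : CommonIndep M₁ M₂ X → (∀ v → v ∈cl₁ A ⊎ v ∈cl₂ B) → ∣ X ∣ ≤ ∣ A ∣ + ∣ B ∣
    dual-bound {X = X} {A = A} {B = B} (indep₁ , indep₂) cover with split cover
    ... | P , P⊆cl₁ , P̸⊆cl₂ = begin
      ∣ X ∣                       ≤⟨ p⊆q⇒∣p∣≤∣q∣ X⊆ ⟩
      ∣ (X ∩ P) ⊔ (X ─ P) ∣       ≤⟨ ∣⊔∣≤ (X ∩ P) (X ─ P) ⟩
      ∣ X ∩ P ∣ + ∣ X ─ P ∣       ≤⟨ ℕₚ.+-mono-≤ (indep⇒≤rank M₁ isRank₁ (indep-down M₁ (p∩q⊆p X P) indep₁))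
                                                (indep⇒≤rank M₂ isRank₂ (indep-down M₂ (p─q⊆p X P) indep₂)) ⟩
      ρ₁ (X ∩ P) + ρ₂ (X ─ P)     ≤⟨ ℕₚ.+-mono-≤ (spans-⊆ first (⊆-⊔ʳ ⊆-refl) (λ v∈ → P⊆cl₁ (p∩q⊆q X P v∈)))
                                                (spans-⊆ second (⊆-⊔ʳ ⊆-refl) (λ v∈ → P̸⊆cl₂ (p─q∌q X P v∈))) ⟩
      ρ₁ A + ρ₂ B                 ≤⟨ ℕₚ.+-mono-≤ (bounded first A) (bounded second B) ⟩
      ∣ A ∣ + ∣ B ∣               ∎
      where
      open ℕₚ.≤-Reasoning
      X⊆ : X ⊆ (X ∩ P) ⊔ (X ─ P)
      X⊆ {x} x∈ with x ∈? P
      ... | yes x∈P = ⊆-⊔ˡ ⊆-refl (x∈p∩q⁺ (x∈ , x∈P))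
      ... | no  x∉P = ⊆-⊔ʳ ⊆-refl (x∈p∧x∉q⇒x∈p─q x∈ x∉P)

    Free : Test n → Subset n → Set
    Free (i , C) X = ∣ C ∣ + ∣ X ∣ ≤ rank i (C ⊔ X)

    Spanned : Test n → Subset n → Fin n → Set
    Spanned (i , C) X v = Closed i v (C ⊔ X)

    Spanned-mono : ∀ t → X ⊆ Y → Spanned t X x → Spanned t Y x
    Spanned-mono (i , C) X⊆Y = cl-mono i (⊔-mono ⊆-refl X⊆Y)

    -- Adding `x` raises the required size by at most one, so a failed test caps the rank at
    -- `∣ C ∣ + ∣ X ∣`, which `X` already reaches.
    rejected⇒spanned : ∀ t → Free t X → ¬ Free t (X ⊔ ⁅ x ⁆) → Spanned t X x
    rejected⇒spanned {X = X} {x = x} (i , C) free ¬free = ℕₚ.≤-trans (ℕₚ.≤-pred (begin-strict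
      rank i (C ⊔ X ⊔ ⁅ x ⁆)      ≤⟨ mono i (⊔-lub (⊔-mono ⊆-refl (⊆-⊔ˡ ⊆-refl)) (⊆-⊔ʳ (⊆-⊔ʳ ⊆-refl))) ⟩
      rank i (C ⊔ (X ⊔ ⁅ x ⁆))    <⟨ ℕₚ.≰⇒> ¬free ⟩
      ∣ C ∣ + ∣ X ⊔ ⁅ x ⁆ ∣       ≤⟨ ℕₚ.+-monoʳ-≤ ∣ C ∣ (∣⊔∣≤ X ⁅ x ⁆) ⟩
      ∣ C ∣ + (∣ X ∣ + ∣ ⁅ x ⁆ ∣) ≡⟨ cong (λ z → ∣ C ∣ + (∣ X ∣ + z)) (∣⁅x⁆∣≡1 x) ⟩
      ∣ C ∣ + (∣ X ∣ + 1)         ≡⟨ solve 2 (λ a b → a :+ (b :+ con 1) := con 1 :+ (a :+ b)) refl ∣ C ∣ ∣ X ∣ ⟩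
      suc (∣ C ∣ + ∣ X ∣)         ∎)) free
      where open ℕₚ.≤-Reasoning

    record Within (q : ℕ) (Q : Subset n → Set) (alg : OracleAlg n) : Set where
      constructor _,_
      field
        correct : Q (output alg ρ₁ ρ₂)
        cost    : queries alg ρ₁ ρ₂ ≤ q

    module _ {q : ℕ} {Q : Subset n → Set} where

      Within-mono : ∀ {q′ alg} → q ≤ q′ → Within q Q alg → Within q′ Q alg
      Within-mono q≤ (out , ≤q) = out , ℕₚ.≤-trans ≤q q≤

      ask-within : ∀ i S {k} → Within q Q (k (rank i S)) → Within (suc q) Q (ask i S k)
      ask-within first  S (out , ≤q) = out , s≤s ≤q
      ask-within second S (out , ≤q) = out , s≤s ≤q

      select-within : {P E : Set} (d : Dec P) {x y : E} {k : E → OracleAlg n} →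
                      (P → Within q Q (k x)) → (¬ P → Within q Q (k y)) → Within q Q (k (select d x y))
      select-within (yes p) f g = f p
      select-within (no ¬p) f g = g ¬p

    -- Maximality is recorded through closures and not through failed tests: closures only grow, so
    -- an element rejected early stays blocked to the end.
    record Maximal (t u : Test n) (Y X₀ : Subset n) (vs : List (Fin n)) (X : Subset n) : Set where
      field
        extends : X₀ ⊆ X
        within  : X ⊆ X₀ ⊔ Y
        freeˡ   : Free t X
        freeʳ   : Free u X
        maximal : ∀ {v} → v List.∈ vs → v ∈ Y → Spanned t X v ⊎ Spanned u X v
    open Maximal

    module _ {Q : Subset n → Set} {q : ℕ} (t u : Test n) (Y : Subset n) {k : Subset n → OracleAlg n} where

      grow-within : ∀ vs X₀ → Free t X₀ → Free u X₀ →
                    (∀ X → Maximal t u Y X₀ vs X → Within q Q (k X)) →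
                    Within (length vs * 2 + q) Q (grow t u Y vs X₀ k)
      grow-within [] X₀ free free′ K = K X₀ record
        { extends = ⊆-refl ; within = ⊆-⊔ˡ ⊆-refl ; freeˡ = free ; freeʳ = free′ ; maximal = λ () }
      grow-within (v ∷ vs) X₀ free free′ K =
        ask-within (proj₁ t) _ (ask-within (proj₁ u) _ (select-within
          (v ∈? Y ×-dec ∣ proj₂ t ∣ + ∣ X₀ ⊔ ⁅ v ⁆ ∣ ≤? rank (proj₁ t) (proj₂ t ⊔ (X₀ ⊔ ⁅ v ⁆))
                  ×-dec ∣ proj₂ u ∣ + ∣ X₀ ⊔ ⁅ v ⁆ ∣ ≤? rank (proj₁ u) (proj₂ u ⊔ (X₀ ⊔ ⁅ v ⁆)))
          {k = λ X → grow t u Y vs X k} accepted rejected))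
        where
        accepted : v ∈ Y × Free t (X₀ ⊔ ⁅ v ⁆) × Free u (X₀ ⊔ ⁅ v ⁆) →
                   Within (length vs * 2 + q) Q (grow t u Y vs (X₀ ⊔ ⁅ v ⁆) k)
        accepted (v∈Y , free⁺ , free′⁺) = grow-within vs (X₀ ⊔ ⁅ v ⁆) free⁺ free′⁺ λ X m → K X record
          { extends = λ x∈ → extends m (⊆-⊔ˡ ⊆-refl x∈)
          ; within  = λ x∈ → ⊔-lub (⊔-lub (⊆-⊔ˡ ⊆-refl) (⊆-⊔ʳ (⁅⁆⊆ v∈Y))) (⊆-⊔ʳ ⊆-refl) (within m x∈)
          ; freeˡ = freeˡ m ; freeʳ = freeʳ m
          ; maximal = λ { (here refl) _ → inj₁ (∈⇒∈cl (proj₁ t) (⊆-⊔ʳ (extends m) (⊆-⊔ʳ ⊆-refl (x∈⁅x⁆ v))))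
                        ; (there w∈) → maximal m w∈ } }
        rejected : ¬ (v ∈ Y × Free t (X₀ ⊔ ⁅ v ⁆) × Free u (X₀ ⊔ ⁅ v ⁆)) →
                   Within (length vs * 2 + q) Q (grow t u Y vs X₀ k)
        rejected ¬ok = grow-within vs X₀ free free′ λ X m → K X record
          { extends = extends m ; within = within m ; freeˡ = freeˡ m ; freeʳ = freeʳ m
          ; maximal = λ { (here refl) v∈Y → Sum.map (Spanned-mono t (extends m)) (Spanned-mono u (extends m)) (blocked v∈Y)
                        ; (there w∈) → maximal m w∈ } }
          where
          blocked : v ∈ Y → Spanned t X₀ v ⊎ Spanned u X₀ v
          blocked v∈Y with ∣ proj₂ t ∣ + ∣ X₀ ⊔ ⁅ v ⁆ ∣ ≤? rank (proj₁ t) (proj₂ t ⊔ (X₀ ⊔ ⁅ v ⁆))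
          ... | no  ¬f = inj₁ (rejected⇒spanned t free ¬f)
          ... | yes f  = inj₂ (rejected⇒spanned u free′ λ f′ → ¬ok (v∈Y , f , f′))

      greedy₂-within : ∀ X₀ → Free t X₀ → Free u X₀ →
                       (∀ X → Maximal t u Y X₀ (allFin n) X → Within q Q (k X)) →
                       Within (n * 2 + q) Q (greedy₂ t u Y X₀ k)
      greedy₂-within X₀ free free′ K =
        subst (λ m → Within (m * 2 + q) Q (greedy₂ t u Y X₀ k)) (length-tabulate {n = n} id)
          (grow-within (allFin n) X₀ free free′ K)

    greedy₁-within : ∀ {Q : Subset n → Set} {q} (t : Test n) (Y : Subset n) {k} → Free t ⊥ →
                     (∀ X → X ⊆ Y → Free t X → (∀ {v} → v ∈ Y → Spanned t X v) → Within q Q (k X)) →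
                     Within (n * 2 + q) Q (greedy₁ t Y k)
    greedy₁-within t Y free K = greedy₂-within t t Y ⊥ free free λ X m →
      K X (λ x∈ → ⊔-lub ⊥⊆ ⊆-refl (within m x∈)) (freeˡ m) (λ {v} v∈ → [ id , id ]′ (maximal m (∈-allFin v) v∈))

  -- The sweeping algorithm

  -- The set A is not stored: it is S without R and F.  The case of no fuel is never reached.
  sweeps : ℕ → Subset n → ℕ → Subset n → Subset n → Subset n → Subset n → OracleAlg n
  sweeps T S zero R F B₁ B₂ = return ⊥
  sweeps T S (suc fuel) R F B₁ B₂ =
    greedy₁ (second , R) B₁ λ B₁ →
    greedy₂ (first , S) (second , R) ⊤ B₁ λ B₁ →
    greedy₁ (second , R ⊔ B₁) F λ F →
    greedy₂ (first , R ⊔ F) (second , S) ⊤ B₂ λ B₂ →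
    greedy₁ (first , R ⊔ F ⊔ B₂) S λ X →
    select (T * ∣ X ∣ ≤? ∣ S ∣)
      (greedy₁ (second , R ⊔ X ⊔ F) B₁ λ P → return (R ⊔ X ⊔ F ⊔ P ⊔ B₂))
      (sweeps T S fuel (R ⊔ X) F B₁ B₂)

  approximate : ℕ → OracleAlg n
  approximate T = greedy₂ (first , ⊥) (second , ⊥) ⊤ ⊥ λ S → sweeps T S T ⊥ S ⊥ ⊥

  -- A sweep makes five passes; the base case pays for the trimming pass before the output.
  sweepCost : ℕ → ℕ → ℕ
  sweepCost n zero = n * 2 + 0
  sweepCost n (suc fuel) = n * 2 + (n * 2 + (n * 2 + (n * 2 + (n * 2 + sweepCost n fuel))))

  sweepCost-zero≤ : ∀ n fuel → sweepCost n 0 ≤ sweepCost n fuel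
  sweepCost-zero≤ n zero = ℕₚ.≤-refl
  sweepCost-zero≤ n (suc fuel) = ℕₚ.+-monoʳ-≤ (n * 2) z≤n

  sweepCost≡ : ∀ n fuel → sweepCost n fuel ≡ fuel * (n * 10) + n * 2
  sweepCost≡ n zero = ℕₚ.+-identityʳ _
  sweepCost≡ n (suc fuel) = trans (cong (λ z → n * 2 + (n * 2 + (n * 2 + (n * 2 + (n * 2 + z))))) (sweepCost≡ n fuel))
    (solve 2 (λ n m → n :* con 2 :+ (n :* con 2 :+ (n :* con 2 :+ (n :* con 2 :+ (n :* con 2 :+ (m :+ n :* con 2)))))
                   := n :* con 10 :+ m :+ n :* con 2) refl n (fuel * (n * 10)))

  -- Invariants and correctness of the sweeps

  module Correctness (M₁ M₂ : Matroid n) {ρ₁ ρ₂ : Subset n → ℕ}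
                     (isRank₁ : IsRankFunction M₁ ρ₁) (isRank₂ : IsRankFunction M₂ ρ₂) where

    open Intersection M₁ M₂ isRank₁ isRank₂
    open Maximal

    free-⊥ : ∀ i → ∣ C ∣ ≤ rank i C → Free (i , C) ⊥
    free-⊥ {C = C} i free = begin
      ∣ C ∣ + ∣ ⊥ {n} ∣   ≡⟨ cong (∣ C ∣ +_) (∣⊥∣≡0 n) ⟩
      ∣ C ∣ + 0           ≡⟨ ℕₚ.+-identityʳ _ ⟩
      ∣ C ∣               ≤⟨ free ⟩
      rank i C            ≤⟨ mono i (⊆-⊔ˡ ⊆-refl) ⟩
      rank i (C ⊔ ⊥)      ∎
      where open ℕₚ.≤-Reasoning

    record IsMaximalCommon (S : Subset n) : Set where
      field
        indep₁  : ∣ S ∣ ≤ ρ₁ S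
        indep₂  : ∣ S ∣ ≤ ρ₂ S
        spanned : ∀ v → v ∈cl₁ S ⊎ v ∈cl₂ S

    module Sweeping {S : Subset n} (S-maximal : IsMaximalCommon S) where
      open IsMaximalCommon S-maximal

      -- What can be added to `S` in the first matroid is outside the first closure of `S`, so
      -- maximality of `S` puts it in the second.
      B₁⊆cl₂S : Free (first , S) X → x ∈ X → x ∈cl₂ S
      B₁⊆cl₂S {x = x} free x∈ = [ (λ x∈cl → contradiction x∈cl (free⇒∉cl first free x∈)) , id ]′ (spanned x)

      B₂⊆cl₁S : Free (second , S) X → x ∈ X → x ∈cl₁ S
      B₂⊆cl₁S {x = x} free x∈ = [ id , (λ x∈cl → contradiction x∈cl (free⇒∉cl second free x∈)) ]′ (spanned x)

      -- This is what survives moving the surplus into `R`. Independence of `R ⊔ B₁ ⊔ F` in the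
      -- second matroid can fail at that point, so it is left to `Swept`. `B₂-spans` has `F` in
      -- place of `R ⊔ F`, which keeps `R` out of the second upper bound on the optimum.
      record Invariant (R F B₁ B₂ : Subset n) : Set where
        field
          R⊆S       : R ⊆ S
          F⊆S       : F ⊆ S
          B₁-free   : Free (first , S) B₁
          B₂-free   : Free (second , S) B₂
          RFB₂-free : ∣ R ∣ + ∣ F ∣ + ∣ B₂ ∣ ≤ ρ₁ (R ⊔ F ⊔ B₂)
          S⊆cl₂     : ∀ {v} → v ∈ S → v ∈cl₂ R ⊔ B₁ ⊔ F
          B₂-spans  : ∀ v → v ∈cl₁ F ⊔ B₂ ⊎ v ∈cl₂ S ⊔ B₂

      -- The state at the end of a sweep, before the surplus `X` joins `R`. `B₁-spans` is obtained
      -- afresh each time, by growing `B₁` again after it has been trimmed.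
      record Swept (R F B₁ B₂ X : Subset n) : Set where
        field
          invariant : Invariant R F B₁ B₂
          X⊆S       : X ⊆ S
          RB₁F-free : ∣ R ∣ + ∣ B₁ ∣ + ∣ F ∣ ≤ ρ₂ (R ⊔ B₁ ⊔ F)
          X-free    : Free (first , R ⊔ F ⊔ B₂) X
          S⊆cl₁     : ∀ {v} → v ∈ S → v ∈cl₁ R ⊔ F ⊔ B₂ ⊔ X
          B₁-spans  : ∀ v → v ∈cl₁ S ⊔ B₁ ⊎ v ∈cl₂ R ⊔ B₁
        open Invariant invariant public

      initial : Invariant ⊥ S ⊥ ⊥
      initial = record
        { R⊆S = ⊥⊆
        ; F⊆S = ⊆-refl
        ; B₁-free = free-⊥ first indep₁
        ; B₂-free = free-⊥ second indep₂
        ; RFB₂-free = begin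
            ∣ ⊥ {n} ∣ + ∣ S ∣ + ∣ ⊥ {n} ∣   ≡⟨ cong (λ z → z + ∣ S ∣ + ∣ ⊥ {n} ∣) (∣⊥∣≡0 n) ⟩
            ∣ S ∣ + ∣ ⊥ {n} ∣               ≤⟨ free-⊥ first indep₁ ⟩
            ρ₁ (S ⊔ ⊥)                      ≤⟨ mono first (⊔-mono (⊆-⊔ʳ ⊆-refl) ⊆-refl) ⟩
            ρ₁ (⊥ ⊔ S ⊔ ⊥)                  ∎
        ; S⊆cl₂ = λ v∈ → ∈⇒∈cl second (⊆-⊔ʳ ⊆-refl v∈)
        ; B₂-spans = λ v → Sum.map (cl-mono first (⊆-⊔ˡ ⊆-refl)) (cl-mono second (⊆-⊔ˡ ⊆-refl)) (spanned v)
        }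
        where open ℕₚ.≤-Reasoning

      module _ {R F B₁ B₂ X : Subset n} (swept : Swept R F B₁ B₂ X) where
        open Swept swept
        open ℕₚ.≤-Reasoning

        RFB₂X-free : ∣ R ∣ + ∣ F ∣ + ∣ B₂ ∣ + ∣ X ∣ ≤ ρ₁ (R ⊔ F ⊔ B₂ ⊔ X)
        RFB₂X-free = begin
          ∣ R ∣ + ∣ F ∣ + ∣ B₂ ∣ + ∣ X ∣   ≤⟨ ℕₚ.+-monoˡ-≤ ∣ X ∣ (ℕₚ.≤-trans RFB₂-free (bounded first _)) ⟩
          ∣ R ⊔ F ⊔ B₂ ∣ + ∣ X ∣           ≤⟨ X-free ⟩
          ρ₁ (R ⊔ F ⊔ B₂ ⊔ X)              ∎

        -- The four sets are counted separately inside an independent set, so `R` and `X` cannot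
        -- overlap. Hence `R` grows by the full size of `X`.
        ∣R∣+∣X∣≤ : ∣ R ∣ + ∣ X ∣ ≤ ∣ R ⊔ X ∣
        ∣R∣+∣X∣≤ = ℕₚ.+-cancelʳ-≤ (∣ F ∣ + ∣ B₂ ∣) _ _ (begin
          ∣ R ∣ + ∣ X ∣ + (∣ F ∣ + ∣ B₂ ∣)
            ≡⟨ solve 4 (λ r x f b → r :+ x :+ (f :+ b) := r :+ f :+ b :+ x) refl (∣ R ∣) (∣ X ∣) (∣ F ∣) (∣ B₂ ∣) ⟩
          ∣ R ∣ + ∣ F ∣ + ∣ B₂ ∣ + ∣ X ∣     ≤⟨ RFB₂X-free ⟩
          ρ₁ (R ⊔ F ⊔ B₂ ⊔ X)
            ≤⟨ mono first (⊔-lub (⊔-lub (⊔-mono (⊆-⊔ˡ ⊆-refl) (⊆-⊔ˡ ⊆-refl)) (⊆-⊔ʳ (⊆-⊔ʳ ⊆-refl))) (⊆-⊔ˡ (⊆-⊔ʳ ⊆-refl))) ⟩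
          ρ₁ (R ⊔ X ⊔ (F ⊔ B₂))              ≤⟨ bounded first _ ⟩
          ∣ R ⊔ X ⊔ (F ⊔ B₂) ∣               ≤⟨ ∣⊔∣≤ (R ⊔ X) (F ⊔ B₂) ⟩
          ∣ R ⊔ X ∣ + ∣ F ⊔ B₂ ∣             ≤⟨ ℕₚ.+-monoʳ-≤ ∣ R ⊔ X ∣ (∣⊔∣≤ F B₂) ⟩
          ∣ R ⊔ X ∣ + (∣ F ∣ + ∣ B₂ ∣)       ∎)

        RFB₂X⊆ : R ⊔ F ⊔ B₂ ⊔ X ⊆ R ⊔ X ⊔ F ⊔ B₂
        RFB₂X⊆ = ⊔-lub (⊔-mono (⊔-mono (⊆-⊔ˡ ⊆-refl) ⊆-refl) ⊆-refl) (⊆-⊔ˡ (⊆-⊔ˡ (⊆-⊔ʳ ⊆-refl)))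

        -- `X` was chosen free over `R ⊔ F ⊔ B₂` in the first matroid, so independence there is
        -- kept; the closure in the second matroid only grows, and `B₂-spans` does not involve `R`.
        advance : Invariant (R ⊔ X) F B₁ B₂
        advance = record
          { R⊆S = ⊔-lub R⊆S X⊆S
          ; F⊆S = F⊆S
          ; B₁-free = B₁-free
          ; B₂-free = B₂-free
          ; RFB₂-free = begin
              ∣ R ⊔ X ∣ + ∣ F ∣ + ∣ B₂ ∣         ≤⟨ ℕₚ.+-monoˡ-≤ ∣ B₂ ∣ (ℕₚ.+-monoˡ-≤ ∣ F ∣ (∣⊔∣≤ R X)) ⟩
              ∣ R ∣ + ∣ X ∣ + ∣ F ∣ + ∣ B₂ ∣
                ≡⟨ solve 4 (λ r x f b → r :+ x :+ f :+ b := r :+ f :+ b :+ x) refl (∣ R ∣) (∣ X ∣) (∣ F ∣) (∣ B₂ ∣) ⟩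
              ∣ R ∣ + ∣ F ∣ + ∣ B₂ ∣ + ∣ X ∣     ≤⟨ RFB₂X-free ⟩
              ρ₁ (R ⊔ F ⊔ B₂ ⊔ X)                ≤⟨ mono first RFB₂X⊆ ⟩
              ρ₁ (R ⊔ X ⊔ F ⊔ B₂)                ∎
          ; S⊆cl₂ = λ v∈ → cl-mono second (⊔-mono (⊔-mono (⊆-⊔ˡ ⊆-refl) ⊆-refl) ⊆-refl) (S⊆cl₂ v∈)
          ; B₂-spans = B₂-spans
          }

        -- Each of the two covers gives a bound by `dual-bound`. In their sum, `R`, `F` and one copy
        -- of `B₁` together cost at most `∣ S ∣`, and the other copy of `B₁` at most
        -- `∣ B₂ ∣ + ∣ X ∣`.
        near-optimal : CommonIndep M₁ M₂ Y → ∣ Y ∣ + ∣ Y ∣ ≤ 3 * (∣ S ∣ + ∣ B₂ ∣) + ∣ X ∣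
        near-optimal {Y = Y} common = begin
          ∣ Y ∣ + ∣ Y ∣
            ≤⟨ ℕₚ.+-mono-≤ (dual-bound common B₁-spans) (dual-bound common B₂-spans) ⟩
          (∣ S ⊔ B₁ ∣ + ∣ R ⊔ B₁ ∣) + (∣ F ⊔ B₂ ∣ + ∣ S ⊔ B₂ ∣)
            ≤⟨ ℕₚ.+-mono-≤ (ℕₚ.+-mono-≤ (∣⊔∣≤ S B₁) (∣⊔∣≤ R B₁)) (ℕₚ.+-mono-≤ (∣⊔∣≤ F B₂) (∣⊔∣≤ S B₂)) ⟩
          ((s + b₁) + (r + b₁)) + ((f + b₂) + (s + b₂))
            ≡⟨ solve 5 (λ s r f b₁ b₂ → ((s :+ b₁) :+ (r :+ b₁)) :+ ((f :+ b₂) :+ (s :+ b₂))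
                         := con 2 :* s :+ (r :+ b₁ :+ f) :+ b₁ :+ con 2 :* b₂) refl s r f b₁ b₂ ⟩
          2 * s + (r + b₁ + f) + b₁ + 2 * b₂
            ≤⟨ ℕₚ.+-monoˡ-≤ (2 * b₂) (ℕₚ.+-mono-≤ (ℕₚ.+-monoʳ-≤ (2 * s) RB₁F≤S) b₁≤) ⟩
          2 * s + s + (b₂ + e) + 2 * b₂
            ≡⟨ solve 3 (λ s b₂ e → con 2 :* s :+ s :+ (b₂ :+ e) :+ con 2 :* b₂ := con 3 :* (s :+ b₂) :+ e) refl s b₂ e ⟩
          3 * (s + b₂) + e ∎
          where
          s = ∣ S ∣ ; r = ∣ R ∣ ; f = ∣ F ∣ ; b₁ = ∣ B₁ ∣ ; b₂ = ∣ B₂ ∣ ; e = ∣ X ∣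
          RB₁F≤S : r + b₁ + f ≤ s
          RB₁F≤S = begin
            r + b₁ + f          ≤⟨ RB₁F-free ⟩
            ρ₂ (R ⊔ B₁ ⊔ F)     ≤⟨ spans-⊆ second (⊔-lub (⊔-mono R⊆S ⊆-refl) (⊆-⊔ˡ F⊆S)) (B₁⊆cl₂S B₁-free) ⟩
            ρ₂ S                ≤⟨ bounded second S ⟩
            s                   ∎
          -- `R ⊔ F ⊔ B₂ ⊔ X` spans the independent set `S` in the first matroid.
          S≤RFB₂X : s ≤ r + f + b₂ + e
          S≤RFB₂X = begin
            s                           ≤⟨ indep₁ ⟩
            ρ₁ S                        ≤⟨ spans-⊆ first (⊆-⊔ʳ ⊆-refl) S⊆cl₁ ⟩
            ρ₁ (R ⊔ F ⊔ B₂ ⊔ X)         ≤⟨ bounded first _ ⟩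
            ∣ R ⊔ F ⊔ B₂ ⊔ X ∣          ≤⟨ ∣⊔∣≤ _ X ⟩
            ∣ R ⊔ F ⊔ B₂ ∣ + e          ≤⟨ ℕₚ.+-monoˡ-≤ e (∣⊔∣≤ _ B₂) ⟩
            ∣ R ⊔ F ∣ + b₂ + e          ≤⟨ ℕₚ.+-monoˡ-≤ e (ℕₚ.+-monoˡ-≤ b₂ (∣⊔∣≤ R F)) ⟩
            r + f + b₂ + e              ∎
          b₁≤ : b₁ ≤ b₂ + e
          b₁≤ = ℕₚ.+-cancelˡ-≤ (r + f) _ _ (begin
            r + f + b₁          ≡⟨ solve 3 (λ r f b → r :+ f :+ b := r :+ b :+ f) refl r f b₁ ⟩
            r + b₁ + f          ≤⟨ ℕₚ.≤-trans RB₁F≤S S≤RFB₂X ⟩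
            r + f + b₂ + e      ≡⟨ ℕₚ.+-assoc (r + f) b₂ e ⟩
            r + f + (b₂ + e)    ∎)

        module _ {P : Subset n} (P⊆B₁ : P ⊆ B₁) (P-free : Free (second , R ⊔ X ⊔ F) P)
                 (B₁⊆cl₂ : ∀ {v} → v ∈ B₁ → v ∈cl₂ R ⊔ X ⊔ F ⊔ P) where

          private
            K = R ⊔ X ⊔ F

            K⊆S : K ⊆ S
            K⊆S = ⊔-lub (⊔-lub R⊆S X⊆S) F⊆S

            B₂-freeK : ∣ K ∣ + ∣ B₂ ∣ ≤ ρ₁ (K ⊔ B₂)
            B₂-freeK = ℕₚ.≤-trans (ℕₚ.+-monoˡ-≤ ∣ B₂ ∣ (∣⊔∣≤ (R ⊔ X) F)) (Invariant.RFB₂-free advance)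

            -- `S` is spanned by `R`, `B₁` and `F`; the first and last lie in `K`, and trimming `B₁`
            -- to `P` loses no closure over `K`.
            S⊆cl₂K : x ∈ S → x ∈cl₂ K ⊔ P
            S⊆cl₂K x∈ = cl-trans second
              (λ y∈ → [ (λ y∈RB₁ → [ (λ y∈R → ∈⇒∈cl second (⊆-⊔ˡ (⊆-⊔ˡ (⊆-⊔ˡ ⊆-refl)) y∈R)) , B₁⊆cl₂ ]′ (⊔⁻ y∈RB₁))
                      , (λ y∈F → ∈⇒∈cl second (⊆-⊔ˡ (⊆-⊔ʳ ⊆-refl) y∈F)) ]′ (⊔⁻ y∈))
              (S⊆cl₂ x∈)

            ∣output∣≤ : ∣ K ⊔ P ⊔ B₂ ∣ ≤ ∣ K ∣ + ∣ P ∣ + ∣ B₂ ∣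
            ∣output∣≤ = ℕₚ.≤-trans (∣⊔∣≤ (K ⊔ P) B₂) (ℕₚ.+-monoˡ-≤ ∣ B₂ ∣ (∣⊔∣≤ K P))

            free₂ : ∣ K ∣ + ∣ P ∣ + ∣ B₂ ∣ ≤ ρ₂ (K ⊔ P ⊔ B₂)
            free₂ = exchange-basis second K⊆S (λ x∈ → B₁⊆cl₂S B₁-free (P⊆B₁ x∈)) S⊆cl₂K P-free B₂-free

          -- `exchange-basis` serves both matroids, with `P` and `B₂` in swapped roles: `K ⊔ B₂` is
          -- a basis of the first closure of `S` and `P` is free over `S` there, while `K ⊔ P` is a
          -- basis of the second closure and `B₂` is free over `S`.
          output-indep : CommonIndep M₁ M₂ (K ⊔ P ⊔ B₂)
          output-indep = ≤rank⇒indep M₁ isRank₁ (begin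
              ∣ K ⊔ P ⊔ B₂ ∣              ≤⟨ ∣output∣≤ ⟩
              ∣ K ∣ + ∣ P ∣ + ∣ B₂ ∣
                ≡⟨ solve 3 (λ k p b → k :+ p :+ b := k :+ b :+ p) refl (∣ K ∣) (∣ P ∣) (∣ B₂ ∣) ⟩
              ∣ K ∣ + ∣ B₂ ∣ + ∣ P ∣      ≤⟨ exchange-basis first K⊆S (B₂⊆cl₁S B₂-free)
                                               (λ x∈ → cl-mono first RFB₂X⊆ (S⊆cl₁ x∈)) B₂-freeK
                                               (free-⊆ first P⊆B₁ B₁-free) ⟩
              ρ₁ (K ⊔ B₂ ⊔ P)             ≤⟨ mono first (⊔-lub (⊔-mono (⊆-⊔ˡ ⊆-refl) ⊆-refl) (⊆-⊔ˡ (⊆-⊔ʳ ⊆-refl))) ⟩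
              ρ₁ (K ⊔ P ⊔ B₂)             ∎)
            , ≤rank⇒indep M₂ isRank₂ (ℕₚ.≤-trans ∣output∣≤ free₂)

          -- `K ⊔ P` spans `S` in the second matroid, and `free₂` keeps `B₂` disjoint from it.
          output-size : ∣ S ∣ + ∣ B₂ ∣ ≤ ∣ K ⊔ P ⊔ B₂ ∣
          output-size = begin
            ∣ S ∣ + ∣ B₂ ∣              ≤⟨ ℕₚ.+-monoˡ-≤ ∣ B₂ ∣ (begin
              ∣ S ∣                       ≤⟨ indep₂ ⟩
              ρ₂ S                        ≤⟨ spans-⊆ second (⊆-⊔ʳ ⊆-refl) S⊆cl₂K ⟩
              ρ₂ (K ⊔ P)                  ≤⟨ bounded second _ ⟩
              ∣ K ⊔ P ∣                   ≤⟨ ∣⊔∣≤ K P ⟩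
              ∣ K ∣ + ∣ P ∣               ∎) ⟩
            ∣ K ∣ + ∣ P ∣ + ∣ B₂ ∣      ≤⟨ free₂ ⟩
            ρ₂ (K ⊔ P ⊔ B₂)             ≤⟨ bounded second _ ⟩
            ∣ K ⊔ P ⊔ B₂ ∣              ∎

      module Step {R F B₁ B₂ : Subset n} (inv : Invariant R F B₁ B₂) where
        open Invariant inv
        open ℕₚ.≤-Reasoning

        RFB₂-free-⊆ : X ⊆ F → ∣ R ∣ + ∣ X ∣ + ∣ B₂ ∣ ≤ ρ₁ (R ⊔ X ⊔ B₂)
        RFB₂-free-⊆ {X = X} X⊆F = begin
          ∣ R ∣ + ∣ X ∣ + ∣ B₂ ∣   ≡⟨ solve 3 (λ r f b → r :+ f :+ b := r :+ b :+ f) refl (∣ R ∣) (∣ X ∣) (∣ B₂ ∣) ⟩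
          ∣ R ∣ + ∣ B₂ ∣ + ∣ X ∣   ≤⟨ free-⊆ first X⊆F (begin
            ∣ R ∣ + ∣ B₂ ∣ + ∣ F ∣   ≡⟨ solve 3 (λ r f b → r :+ b :+ f := r :+ f :+ b) refl (∣ R ∣) (∣ F ∣) (∣ B₂ ∣) ⟩
            ∣ R ∣ + ∣ F ∣ + ∣ B₂ ∣   ≤⟨ RFB₂-free ⟩
            ρ₁ (R ⊔ F ⊔ B₂)          ≤⟨ mono first (⊔-lub (⊔-mono (⊆-⊔ˡ ⊆-refl) ⊆-refl) (⊆-⊔ˡ (⊆-⊔ʳ ⊆-refl))) ⟩
            ρ₁ (R ⊔ B₂ ⊔ F)          ∎) ⟩
          ρ₁ (R ⊔ B₂ ⊔ X)          ≤⟨ mono first (⊔-lub (⊔-mono (⊆-⊔ˡ ⊆-refl) ⊆-refl) (⊆-⊔ˡ (⊆-⊔ʳ ⊆-refl))) ⟩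
          ρ₁ (R ⊔ X ⊔ B₂)          ∎

        module _ {B₁⁻ B₁⁺ F′ B₂⁺ X : Subset n}
                 (B₁⁻-spans : ∀ {v} → v ∈ B₁ → v ∈cl₂ R ⊔ B₁⁻)
                 (B₁⁺-max : Maximal (first , S) (second , R) ⊤ B₁⁻ (allFin n) B₁⁺)
                 (F′⊆F : F′ ⊆ F) (F′-free : Free (second , R ⊔ B₁⁺) F′)
                 (F′-spans : ∀ {v} → v ∈ F → v ∈cl₂ R ⊔ B₁⁺ ⊔ F′)
                 (B₂⁺-max : Maximal (first , R ⊔ F′) (second , S) ⊤ B₂ (allFin n) B₂⁺)
                 (X⊆S : X ⊆ S) (X-free : Free (first , R ⊔ F′ ⊔ B₂⁺) X)
                 (X-spans : ∀ {v} → v ∈ S → v ∈cl₁ R ⊔ F′ ⊔ B₂⁺ ⊔ X) where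

          private
            -- A new element of `B₂⁺` is independent of `S ⊔ B₂` in the second matroid, so the old
            -- `B₂-spans` leaves only the first alternative for it.
            B₂⁺⊆cl : x ∈ B₂⁺ → x ∈cl₁ F ⊔ B₂
            B₂⁺⊆cl {x = x} x∈ with x ∈? B₂ | B₂-spans x
            ... | yes x∈B₂ | _ = ∈⇒∈cl first (⊆-⊔ʳ ⊆-refl x∈B₂)
            ... | no  _    | inj₁ x∈cl = x∈cl
            ... | no  x∉B₂ | inj₂ x∈cl = contradiction (begin-strict
              ∣ S ∣ + ∣ B₂ ∣
                <⟨ ℕₚ.≤-reflexive (trans (sym (ℕₚ.+-suc ∣ S ∣ _)) (cong (∣ S ∣ +_) (sym (∣∣-suc x∉B₂)))) ⟩
              ∣ S ∣ + ∣ B₂ ⊔ ⁅ x ⁆ ∣       ≤⟨ free-⊆ second (⊔-lub (extends B₂⁺-max) (⁅⁆⊆ x∈)) (freeʳ B₂⁺-max) ⟩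
              ρ₂ (S ⊔ (B₂ ⊔ ⁅ x ⁆))        ≤⟨ mono second (⊔-lub (⊆-⊔ˡ (⊆-⊔ˡ ⊆-refl)) (⊔-mono (⊆-⊔ʳ ⊆-refl) ⊆-refl)) ⟩
              ρ₂ (S ⊔ B₂ ⊔ ⁅ x ⁆)          ≤⟨ x∈cl ⟩
              ρ₂ (S ⊔ B₂)                  ≤⟨ bounded second _ ⟩
              ∣ S ⊔ B₂ ∣                   ≤⟨ ∣⊔∣≤ S B₂ ⟩
              ∣ S ∣ + ∣ B₂ ∣               ∎) (ℕₚ.<-irrefl refl)

            R-free : ρ₁ (F ⊔ B₂) + ∣ R ∣ ≤ ρ₁ (F ⊔ B₂ ⊔ R)
            R-free = begin
              ρ₁ (F ⊔ B₂) + ∣ R ∣        ≤⟨ ℕₚ.+-monoˡ-≤ ∣ R ∣ (ℕₚ.≤-trans (bounded first _) (∣⊔∣≤ F B₂)) ⟩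
              ∣ F ∣ + ∣ B₂ ∣ + ∣ R ∣
                ≡⟨ solve 3 (λ r f b → f :+ b :+ r := r :+ f :+ b) refl (∣ R ∣) (∣ F ∣) (∣ B₂ ∣) ⟩
              ∣ R ∣ + ∣ F ∣ + ∣ B₂ ∣     ≤⟨ RFB₂-free ⟩
              ρ₁ (R ⊔ F ⊔ B₂)
                ≤⟨ mono first (⊔-lub (⊔-lub (⊆-⊔ʳ ⊆-refl) (⊆-⊔ˡ (⊆-⊔ˡ ⊆-refl))) (⊆-⊔ˡ (⊆-⊔ʳ ⊆-refl))) ⟩
              ρ₁ (F ⊔ B₂ ⊔ R)            ∎

            -- Maximality of `B₂⁺` alone would leave `R` in the first closure. The old cover removes
            -- it: `v` and `F′ ⊔ B₂⁺` lie in the first closure of `F ⊔ B₂`, over which `R` is free,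
            -- so `cl-cancel` applies.
            B₂⁺-spans : ∀ v → v ∈cl₁ F′ ⊔ B₂⁺ ⊎ v ∈cl₂ S ⊔ B₂⁺
            B₂⁺-spans v with maximal B₂⁺-max (∈-allFin v) ∈⊤ | B₂-spans v
            ... | inj₂ v∈ | _ = inj₂ v∈
            ... | inj₁ _  | inj₂ v∈ = inj₂ (cl-mono second (⊔-mono ⊆-refl (extends B₂⁺-max)) v∈)
            ... | inj₁ v∈ | inj₁ v∈FB₂ = inj₁ (cl-cancel first
              (λ y∈ → [ (λ y∈F′ → ∈⇒∈cl first (⊆-⊔ˡ F′⊆F y∈F′)) , B₂⁺⊆cl ]′ (⊔⁻ y∈))
              v∈FB₂ R-free
              (cl-mono first (⊔-lub (⊔-mono ⊆-refl (⊆-⊔ˡ ⊆-refl)) (⊆-⊔ʳ (⊆-⊔ʳ ⊆-refl))) v∈))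

          swept : Swept R F′ B₁⁺ B₂⁺ X
          swept = record
            { invariant = record
              { R⊆S = R⊆S
              ; F⊆S = λ x∈ → F⊆S (F′⊆F x∈)
              ; B₁-free = freeˡ B₁⁺-max
              ; B₂-free = freeʳ B₂⁺-max
              ; RFB₂-free = begin
                  ∣ R ∣ + ∣ F′ ∣ + ∣ B₂⁺ ∣
                    -- Restriction to `R ⊔ F′` shows these two sets disjoint, which turns the sum
                    -- into the cardinality used by the greedy test.
                    ≤⟨ ℕₚ.+-monoˡ-≤ ∣ B₂⁺ ∣ (ℕₚ.≤-trans (free-restrict first (RFB₂-free-⊆ F′⊆F)) (bounded first _)) ⟩
                  ∣ R ⊔ F′ ∣ + ∣ B₂⁺ ∣       ≤⟨ freeˡ B₂⁺-max ⟩
                  ρ₁ (R ⊔ F′ ⊔ B₂⁺)          ∎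
              -- Discarding loses no closure: what left `B₁` is spanned by `R ⊔ B₁⁻`, and what left
              -- `F` by `R ⊔ B₁⁺ ⊔ F′`.
              ; S⊆cl₂ = λ v∈ → cl-trans second
                  (λ y∈ → [ (λ y∈RB₁ → [ (λ y∈R → ∈⇒∈cl second (⊆-⊔ˡ (⊆-⊔ˡ ⊆-refl) y∈R))
                                       , (λ y∈B₁ → cl-mono second (⊆-⊔ˡ (⊔-mono ⊆-refl (extends B₁⁺-max))) (B₁⁻-spans y∈B₁)) ]′ (⊔⁻ y∈RB₁))
                          , F′-spans ]′ (⊔⁻ y∈))
                  (S⊆cl₂ v∈)
              ; B₂-spans = B₂⁺-spans
              }
            ; X⊆S = X⊆S
            ; RB₁F-free = begin
                ∣ R ∣ + ∣ B₁⁺ ∣ + ∣ F′ ∣   ≤⟨ ℕₚ.+-monoˡ-≤ ∣ F′ ∣ (ℕₚ.≤-trans (freeʳ B₁⁺-max) (bounded second _)) ⟩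
                ∣ R ⊔ B₁⁺ ∣ + ∣ F′ ∣       ≤⟨ F′-free ⟩
                ρ₂ (R ⊔ B₁⁺ ⊔ F′)          ∎
            ; X-free = X-free
            ; S⊆cl₁ = X-spans
            ; B₁-spans = λ v → maximal B₁⁺-max (∈-allFin v) ∈⊤
            }

      -- Multiplying by `T` avoids fractions; the last summand stands for an error of `∣ S ∣ / T`.
      Approximate : ℕ → Subset n → Set
      Approximate T Z = CommonIndep M₁ M₂ Z × (∀ {Y} → CommonIndep M₁ M₂ Y → T * (∣ Y ∣ + ∣ Y ∣) ≤ T * (3 * ∣ Z ∣) + ∣ S ∣)

      -- A potential argument: a sweep that does not stop has `T * ∣ X ∣ > ∣ S ∣`, so it raises
      -- `T * ∣ R ∣` by at least `suc ∣ S ∣` and makes up for the unit of fuel spent.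
      sweeps-within : ∀ T .{{_ : NonZero T}} fuel {R F B₁ B₂} → Invariant R F B₁ B₂ →
                      T * suc ∣ S ∣ ≤ T * ∣ R ∣ + fuel * suc ∣ S ∣ →
                      Within (sweepCost n fuel) (Approximate T) (sweeps T S fuel R F B₁ B₂)
      -- Without fuel the potential would force `∣ R ∣` above `∣ S ∣`, against `R ⊆ S`.
      sweeps-within T zero {R} inv enough = contradiction
        (ℕₚ.*-cancelˡ-≤ T (ℕₚ.≤-trans enough (ℕₚ.≤-reflexive (ℕₚ.+-identityʳ _))))
        (ℕₚ.<⇒≱ (s≤s (p⊆q⇒∣p∣≤∣q∣ (Invariant.R⊆S inv))))
      sweeps-within T (suc fuel) {R} inv enough =
        greedy₁-within (second , R) _ (free-⊥ second (indep-⊆ second R⊆S indep₂)) λ B₁⁻ B₁⁻⊆ B₁⁻-free B₁⁻-spans →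
        greedy₂-within (first , S) (second , R) ⊤ B₁⁻ (free-⊆ first B₁⁻⊆ B₁-free) B₁⁻-free λ B₁⁺ B₁⁺-max →
        greedy₁-within (second , R ⊔ B₁⁺) _ (free-⊥ second (free⇒indep second (freeʳ B₁⁺-max))) λ F′ F′⊆F F′-free F′-spans →
        greedy₂-within (first , R ⊔ F′) (second , S) ⊤ _
          (ℕₚ.≤-trans (ℕₚ.+-monoˡ-≤ _ (∣⊔∣≤ R F′)) (RFB₂-free-⊆ F′⊆F)) B₂-free λ B₂⁺ B₂⁺-max →
        greedy₁-within (first , R ⊔ F′ ⊔ B₂⁺) S (free-⊥ first (free⇒indep first (freeˡ B₂⁺-max))) λ X X⊆S X-free X-spans →
        let swept = Step.swept inv B₁⁻-spans B₁⁺-max F′⊆F F′-free F′-spans B₂⁺-max X⊆S X-free X-spans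
        in select-within (T * ∣ X ∣ ≤? ∣ S ∣) {k = id}
          (λ small → Within-mono (sweepCost-zero≤ n fuel) (greedy₁-within (second , R ⊔ X ⊔ F′) B₁⁺
            (free-⊥ second (indep-⊆ second (⊔-lub (⊔-lub R⊆S X⊆S) (λ x∈ → F⊆S (F′⊆F x∈))) indep₂))
            λ P P⊆B₁ P-free P-spans →
              (output-indep swept P⊆B₁ P-free P-spans , λ {Y} common → begin
                T * (∣ Y ∣ + ∣ Y ∣)                                   ≤⟨ ℕₚ.*-monoʳ-≤ T (near-optimal swept common) ⟩
                T * (3 * (∣ S ∣ + ∣ B₂⁺ ∣) + ∣ X ∣)                   ≡⟨ ℕₚ.*-distribˡ-+ T _ ∣ X ∣ ⟩
                T * (3 * (∣ S ∣ + ∣ B₂⁺ ∣)) + T * ∣ X ∣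
                  ≤⟨ ℕₚ.+-mono-≤ (ℕₚ.*-monoʳ-≤ T (ℕₚ.*-monoʳ-≤ 3 (output-size swept P⊆B₁ P-free P-spans))) small ⟩
                T * (3 * ∣ R ⊔ X ⊔ F′ ⊔ P ⊔ B₂⁺ ∣) + ∣ S ∣            ∎)
              , z≤n))
          (λ large → sweeps-within T fuel (advance swept) (begin
            T * suc ∣ S ∣                                         ≤⟨ enough ⟩
            T * ∣ R ∣ + (suc ∣ S ∣ + fuel * suc ∣ S ∣)
              ≤⟨ ℕₚ.+-monoʳ-≤ (T * ∣ R ∣) (ℕₚ.+-monoˡ-≤ _ (ℕₚ.≰⇒> large)) ⟩
            T * ∣ R ∣ + (T * ∣ X ∣ + fuel * suc ∣ S ∣)            ≡⟨ ℕₚ.+-assoc (T * ∣ R ∣) _ _ ⟨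
            T * ∣ R ∣ + T * ∣ X ∣ + fuel * suc ∣ S ∣
              ≡⟨ cong (_+ fuel * suc ∣ S ∣) (ℕₚ.*-distribˡ-+ T ∣ R ∣ ∣ X ∣) ⟨
            T * (∣ R ∣ + ∣ X ∣) + fuel * suc ∣ S ∣                ≤⟨ ℕₚ.+-monoˡ-≤ _ (ℕₚ.*-monoʳ-≤ T (∣R∣+∣X∣≤ swept)) ⟩
            T * ∣ R ⊔ X ∣ + fuel * suc ∣ S ∣                      ∎))
        where
        open Invariant inv
        open Step inv
        open ℕₚ.≤-Reasoning

    approximate-within : ∀ T .{{_ : NonZero T}} → Within (n * 2 + sweepCost n T)
      (λ Z → CommonIndep M₁ M₂ Z × (∀ {r} → IsMaxCommonSize M₁ M₂ r → T * (r + r) ≤ T * (3 * ∣ Z ∣) + r)) (approximate T)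
    approximate-within T = greedy₂-within (first , ⊥) (second , ⊥) ⊤ ⊥ (free-⊥ first (∣⊥∣≤ _)) (free-⊥ second (∣⊥∣≤ _)) λ S S-max →
      let S-maximal = maximalCommon S-max
          open IsMaximalCommon S-maximal
          open Sweeping S-maximal
          (out-indep , bound) , few = sweeps-within T T initial (ℕₚ.m≤n+m _ _)
      in (out-indep , λ { ((O , O-indep , refl) , max) → ℕₚ.≤-trans (bound O-indep)
            -- `S` is itself a common independent set, so the error `∣ S ∣` is at most `r`.
            (ℕₚ.+-monoʳ-≤ _ (max S (≤rank⇒indep M₁ isRank₁ indep₁ , ≤rank⇒indep M₂ isRank₂ indep₂))) }) , few
      where
      ∣⊥∣≤ : ∀ k → ∣ ⊥ {n} ∣ ≤ k
      ∣⊥∣≤ k = subst (_≤ k) (sym (∣⊥∣≡0 n)) z≤n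
      without-⊥ : ∀ i → Free (i , ⊥) X → ∣ X ∣ ≤ rank i X
      without-⊥ i free = ℕₚ.≤-trans (ℕₚ.m≤n+m _ _) (ℕₚ.≤-trans free (mono i (⊔-lub ⊥⊆ ⊆-refl)))
      maximalCommon : Maximal (first , ⊥) (second , ⊥) ⊤ ⊥ (allFin n) X → IsMaximalCommon X
      maximalCommon m = record
        { indep₁ = without-⊥ first (freeˡ m)
        ; indep₂ = without-⊥ second (freeʳ m)
        ; spanned = λ v → Sum.map (cl-mono first (⊔-lub ⊥⊆ ⊆-refl)) (cl-mono second (⊔-lub ⊥⊆ ⊆-refl)) (maximal m (∈-allFin v) ∈⊤)
        }

  -- Arithmetic of the bounds

  module _ (p q : ℕ) .{{_ : NonZero p}} where

    -- With `ε = p / q` this is the floor of `1 / ε` plus one: large enough that its inverse is at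
    -- most `ε`, and at most `1 + 1 / ε`.
    rounds : ℕ
    rounds = suc (q / p)

    q≤rounds*p : q ≤ rounds * p
    q≤rounds*p = ℕₚ.≤-trans (ℕₚ.≤-reflexive (DivMod.m≡m%n+[m/n]*n q p)) (ℕₚ.+-monoˡ-≤ _ (DivMod.m%n≤n q p))

    rounds*p≤p+q : rounds * p ≤ p + q
    rounds*p≤p+q = ℕₚ.+-monoʳ-≤ p (DivMod.m/n*n≤m q p)

    approximation-ℕ : ∀ r o → rounds * (r + r) ≤ rounds * (3 * o) + r →
                      2 * r * q ≤ 3 * o * q + 3 * p * r
    approximation-ℕ r o bound = ℕₚ.*-cancelˡ-≤ rounds (begin
      T * (2 * r * q)
        ≡⟨ solve 3 (λ T r q → T :* (con 2 :* r :* q) := T :* (r :+ r) :* q) refl T r q ⟩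
      T * (r + r) * q                         ≤⟨ ℕₚ.*-monoˡ-≤ q bound ⟩
      (T * (3 * o) + r) * q                 ≡⟨ ℕₚ.*-distribʳ-+ q (T * (3 * o)) r ⟩
      T * (3 * o) * q + r * q             ≤⟨ ℕₚ.+-monoʳ-≤ (T * (3 * o) * q) (ℕₚ.*-monoʳ-≤ r q≤rounds*p) ⟩
      T * (3 * o) * q + r * (T * p)
        ≡⟨ solve 5 (λ T o q r p → T :* (con 3 :* o) :* q :+ r :* (T :* p)
              := T :* (con 3 :* o :* q :+ p :* r)) refl T o q r p ⟩
      -- The error is only `p * r`; the factor 3 is slack, since the target allows an error of `ε r`
      -- in `o` and not merely in `3 * o`.
      T * (3 * o * q + p * r)             ≤⟨ ℕₚ.*-monoʳ-≤ T (ℕₚ.+-monoʳ-≤ (3 * o * q) (ℕₚ.*-monoˡ-≤ r (ℕₚ.m≤n*m p 3))) ⟩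
      T * (3 * o * q + 3 * p * r)       ∎)
      where
      open ℕₚ.≤-Reasoning
      T = rounds

    -- Each sweep costs ten queries per element, and the first and last passes cost four together.
    -- From `p ≤ q` follows `rounds * p ≤ 2 * q`, whence 10 * 2 + 4 = 24.
    query-bound-ℕ : ∀ Q n → p ≤ q → Q ≤ n * 2 + (rounds * (n * 10) + n * 2) →
                    Q * p ≤ 24 * (n * q + p)
    query-bound-ℕ Q n p≤q bound = begin
      Q * p                                                 ≤⟨ ℕₚ.*-monoˡ-≤ p bound ⟩
      (n * 2 + (T * (n * 10) + n * 2)) * p
        ≡⟨ solve 3 (λ n T p → (n :* con 2 :+ (T :* (n :* con 10) :+ n :* con 2)) :* p
              := n :* (con 10 :* (T :* p) :+ con 4 :* p)) refl n T p ⟩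
      n * (10 * (T * p) + 4 * p)
        ≤⟨ ℕₚ.*-monoʳ-≤ n (ℕₚ.+-mono-≤ (ℕₚ.*-monoʳ-≤ 10 (ℕₚ.≤-trans rounds*p≤p+q (ℕₚ.+-monoˡ-≤ q p≤q))) (ℕₚ.*-monoʳ-≤ 4 p≤q)) ⟩
      n * (10 * (q + q) + 4 * q)
        ≡⟨ solve 2 (λ n q → n :* (con 10 :* (q :+ q) :+ con 4 :* q) := con 24 :* (n :* q)) refl n q ⟩
      24 * (n * q)                                        ≤⟨ ℕₚ.*-monoʳ-≤ 24 (ℕₚ.m≤m+n (n * q) p) ⟩
      24 * (n * q + p)                                  ∎
      where
      open ℕₚ.≤-Reasoning
      T = rounds

  -- For `ε > 1` the ratio `2/3 - ε` is negative, so the empty set is good enough; the other case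
  -- supplies the `p ≤ q` of `query-bound-ℕ`.
  algorithm : ℕ → (p : ℕ) .{{_ : NonZero p}} → ∀ n → OracleAlg n
  algorithm q p n = select (p ≤? q) (approximate (rounds p q)) (return ⊥)

  algorithm-correct : ∀ q p .{{_ : NonZero p}} (M₁ M₂ : Matroid n) {ρ₁ ρ₂ : Subset n → ℕ} →
                      IsRankFunction M₁ ρ₁ → IsRankFunction M₂ ρ₂ → ∀ {r} → IsMaxCommonSize M₁ M₂ r →
                      let Z = output (algorithm q p n) ρ₁ ρ₂ in
                      CommonIndep M₁ M₂ Z ×
                      2 * r * q ≤ 3 * ∣ Z ∣ * q + 3 * p * r ×
                      queries (algorithm q p n) ρ₁ ρ₂ * p ≤ 24 * (n * q + p)
  algorithm-correct {n} q p M₁ M₂ {ρ₁} {ρ₂} isRank₁ isRank₂ {r} r-max with p ≤? q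
  ... | yes p≤q = indep , approximation-ℕ p q r ∣ output alg ρ₁ ρ₂ ∣ (approx r-max)
    , query-bound-ℕ p q (queries alg ρ₁ ρ₂) n p≤q (subst (λ z → queries alg ρ₁ ρ₂ ≤ n * 2 + z) (sweepCost≡ n (rounds p q)) few)
    where
    alg = approximate (rounds p q)
    open Correctness M₁ M₂ isRank₁ isRank₂
    open Intersection.Within (approximate-within (rounds p q)) renaming (cost to few)
    indep = proj₁ correct
    approx = proj₂ correct
  ... | no p≰q = (indep-∅ M₁ , indep-∅ M₂) , (begin
      2 * r * q                            ≤⟨ ℕₚ.*-mono-≤ (ℕₚ.*-monoˡ-≤ r (ℕₚ.n≤1+n 2)) (ℕₚ.≰⇒≥ p≰q) ⟩
      3 * r * p                            ≡⟨ solve 2 (λ r p → con 3 :* r :* p := con 3 :* p :* r) refl r p ⟩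
      3 * p * r                            ≤⟨ ℕₚ.m≤n+m (3 * p * r) _ ⟩
      3 * ∣ ⊥ {n} ∣ * q + 3 * p * r        ∎)
    , z≤n
    where open ℕₚ.≤-Reasoning

-- The bounds over the integers

module Integers where

  import Data.Nat as ℕ
  open import Data.Integer using (+_; +≤+; _*_; _+_; _-_; -_; _≤_)
  import Data.Integer.Properties as ℤₚ
  open import Data.Integer.Solver using (module +-*-Solver)
  open +-*-Solver using (solve; _:=_; _:+_; _:*_; _:-_; :-_; con)
  open ℤₚ.≤-Reasoning

  pos-*³ : ∀ a b c → + (a ℕ.* b ℕ.* c) ≡ + a * + b * + c
  pos-*³ a b c = trans (ℤₚ.pos-* (a ℕ.* b) c) (cong (_* + c) (ℤₚ.pos-* a b))

  -- The factors `+ 1` and the order of the products are what the comparison of unnormalised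
  -- fractions unfolds to, so that `*≤*` accepts the result.
  approximation-ℤ : ∀ p q r o → 2 ℕ.* r ℕ.* q ℕ.≤ 3 ℕ.* o ℕ.* q ℕ.+ 3 ℕ.* p ℕ.* r →
                    (+ 2 * + q + (- + p) * + 3) * + r * + 1 ≤ + o * + (3 ℕ.* q ℕ.* 1)
  approximation-ℤ p q r o bound = begin
    (+ 2 * + q + (- + p) * + 3) * + r * + 1
      ≡⟨ solve 3 (λ q p r → (con (+ 2) :* q :+ (:- p) :* con (+ 3)) :* r :* con (+ 1)
                         := con (+ 2) :* r :* q :- con (+ 3) :* p :* r) refl (+ q) (+ p) (+ r) ⟩
    + 2 * + r * + q - + 3 * + p * + r
      ≡⟨ cong₂ _-_ (pos-*³ 2 r q) (pos-*³ 3 p r) ⟨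
    + (2 ℕ.* r ℕ.* q) - + (3 ℕ.* p ℕ.* r)
      ≤⟨ ℤₚ.+-monoˡ-≤ (- + (3 ℕ.* p ℕ.* r)) (+≤+ bound) ⟩
    + (3 ℕ.* o ℕ.* q ℕ.+ 3 ℕ.* p ℕ.* r) - + (3 ℕ.* p ℕ.* r)
      ≡⟨ cong (_- + (3 ℕ.* p ℕ.* r)) (ℤₚ.pos-+ (3 ℕ.* o ℕ.* q) _) ⟩
    + (3 ℕ.* o ℕ.* q) + + (3 ℕ.* p ℕ.* r) - + (3 ℕ.* p ℕ.* r)
      ≡⟨ solve 2 (λ a b → a :+ b :- b := a) refl (+ (3 ℕ.* o ℕ.* q)) (+ (3 ℕ.* p ℕ.* r)) ⟩
    + (3 ℕ.* o ℕ.* q)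
      ≡⟨ pos-*³ 3 o q ⟩
    + 3 * + o * + q
      ≡⟨ solve 2 (λ o q → con (+ 3) :* o :* q := o :* (con (+ 3) :* q :* con (+ 1))) refl (+ o) (+ q) ⟩
    + o * (+ 3 * + q * + 1)
      ≡⟨ cong (+ o *_) (pos-*³ 3 q 1) ⟨
    + o * + (3 ℕ.* q ℕ.* 1) ∎

  query-bound-ℤ : ∀ p q Q C n → Q ℕ.* p ℕ.≤ C ℕ.* (n ℕ.* q ℕ.+ p) →
                  + Q * + p * + (1 ℕ.* (1 ℕ.* q)) ≤ + C * (+ n * + q + + p * + 1) * + (1 ℕ.* q)
  query-bound-ℤ p q Q C n bound = begin
    + Q * + p * + (1 ℕ.* (1 ℕ.* q))
      ≡⟨ cong₂ (λ a b → a * + b) (sym (ℤₚ.pos-* Q p)) (ℕₚ.+-identityʳ _) ⟩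
    + (Q ℕ.* p) * + (1 ℕ.* q)
      ≤⟨ ℤₚ.*-monoʳ-≤-nonNeg (+ (1 ℕ.* q)) (+≤+ bound) ⟩
    + (C ℕ.* (n ℕ.* q ℕ.+ p)) * + (1 ℕ.* q)
      ≡⟨ cong (_* + (1 ℕ.* q)) (trans (ℤₚ.pos-* C _) (cong (+ C *_) (trans (ℤₚ.pos-+ (n ℕ.* q) p)
           (cong₂ _+_ (ℤₚ.pos-* n q) (sym (ℤₚ.*-identityʳ (+ p))))))) ⟩
    + C * (+ n * + q + + p * + 1) * + (1 ℕ.* q) ∎

-- The bounds over the rationals, and the theorem

import Data.Nat as ℕ
open import Data.Integer using (+_; -[1+_])
open import Data.Rational using (ℚ; mkℚ; _/_; _<_; _≤_; _-_; _*_; _+_; -_; Positive; toℚᵘ)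
import Data.Rational.Properties as ℚₚ
open import Data.Rational.Unnormalised using (ℚᵘ; mkℚᵘ; *≤*)
import Data.Rational.Unnormalised as ℚᵘ
import Data.Rational.Unnormalised.Properties as ℚᵘₚ

fromℕ : ℕ → ℚᵘ
fromℕ m = mkℚᵘ (+ m) 0

toℚᵘ-/1 : ∀ m → toℚᵘ (+ m / 1) ℚᵘ.≃ fromℕ m
toℚᵘ-/1 m = ℚₚ.toℚᵘ-fromℚᵘ (fromℕ m)

module _ (p q-1 : ℕ) .(coprime : Coprime p (suc q-1)) where

  open ℚᵘₚ.≤-Reasoning

  private
    ε  = mkℚ (+ p) q-1 coprime
    εᵘ = mkℚᵘ (+ p) q-1

  -- Arithmetic on `ℚ` reduces fractions, so the inequality is moved to `ℚᵘ`, where cross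
  -- multiplication leaves the integer statement.
  approximation-ℚ : ∀ r o → 2 ℕ.* r ℕ.* suc q-1 ℕ.≤ 3 ℕ.* o ℕ.* suc q-1 ℕ.+ 3 ℕ.* p ℕ.* r →
                    (+ 2 / 3 - ε) * (+ r / 1) ≤ + o / 1
  approximation-ℚ r o bound = ℚₚ.toℚᵘ-cancel-≤ (begin
    toℚᵘ ((+ 2 / 3 - ε) * (+ r / 1))
      ≃⟨ ℚₚ.toℚᵘ-homo-* (+ 2 / 3 - ε) (+ r / 1) ⟩
    toℚᵘ (+ 2 / 3 - ε) ℚᵘ.* toℚᵘ (+ r / 1)
      ≃⟨ ℚᵘₚ.*-cong (ℚₚ.toℚᵘ-homo-+ (+ 2 / 3) (- ε)) (toℚᵘ-/1 r) ⟩
    (mkℚᵘ (+ 2) 2 ℚᵘ.+ toℚᵘ (- ε)) ℚᵘ.* fromℕ r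
      ≃⟨ ℚᵘₚ.*-congʳ {fromℕ r} (ℚᵘₚ.+-congʳ (mkℚᵘ (+ 2) 2) (ℚₚ.toℚᵘ-homo‿- ε)) ⟩
    (mkℚᵘ (+ 2) 2 ℚᵘ.+ ℚᵘ.- εᵘ) ℚᵘ.* fromℕ r
      ≤⟨ *≤* (Integers.approximation-ℤ p (suc q-1) r o bound) ⟩
    fromℕ o
      ≃⟨ toℚᵘ-/1 o ⟨
    toℚᵘ (+ o / 1) ∎)

  query-bound-ℚ : ∀ Q C n → Q ℕ.* p ℕ.≤ C ℕ.* (n ℕ.* suc q-1 ℕ.+ p) →
                  (+ Q / 1) * ε ≤ (+ C / 1) * ((+ n / 1) + ε)
  query-bound-ℚ Q C n bound = ℚₚ.toℚᵘ-cancel-≤ (begin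
    toℚᵘ ((+ Q / 1) * ε)
      ≃⟨ ℚₚ.toℚᵘ-homo-* (+ Q / 1) ε ⟩
    toℚᵘ (+ Q / 1) ℚᵘ.* εᵘ
      ≃⟨ ℚᵘₚ.*-congʳ {εᵘ} (toℚᵘ-/1 Q) ⟩
    fromℕ Q ℚᵘ.* εᵘ
      ≤⟨ *≤* (Integers.query-bound-ℤ p (suc q-1) Q C n bound) ⟩
    fromℕ C ℚᵘ.* (fromℕ n ℚᵘ.+ εᵘ)
      ≃⟨ ℚᵘₚ.*-cong (toℚᵘ-/1 C) (ℚᵘₚ.+-congˡ εᵘ (toℚᵘ-/1 n)) ⟨
    toℚᵘ (+ C / 1) ℚᵘ.* (toℚᵘ (+ n / 1) ℚᵘ.+ εᵘ)
      ≃⟨ ℚᵘₚ.*-congˡ {toℚᵘ (+ C / 1)} (ℚₚ.toℚᵘ-homo-+ (+ n / 1) ε) ⟨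
    toℚᵘ (+ C / 1) ℚᵘ.* toℚᵘ ((+ n / 1) + ε)
      ≃⟨ ℚₚ.toℚᵘ-homo-* (+ C / 1) ((+ n / 1) + ε) ⟨
    toℚᵘ ((+ C / 1) * ((+ n / 1) + ε)) ∎)

open Matroids

theorem2 : Σ ℕ λ C → (ε : ℚ) → .{{_ : Positive ε}} →
    Σ ((n : ℕ) → OracleAlg n) λ A →
    ∀ (n : ℕ) (M₁ M₂ : Matroid n) (ρ₁ ρ₂ : Subset n → ℕ) →
    IsRankFunction M₁ ρ₁ → IsRankFunction M₂ ρ₂ →
    (r : ℕ) → IsMaxCommonSize M₁ M₂ r →
    CommonIndep M₁ M₂ (output (A n) ρ₁ ρ₂) ×
    ((+ 2 / 3 - ε) * (+ r / 1) ≤ + ∣ output (A n) ρ₁ ρ₂ ∣ / 1) ×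
    ((+ queries (A n) ρ₁ ρ₂ / 1) * ε ≤ (+ C / 1) * ((+ n / 1) + ε))
theorem2 = 24 , λ where
  (mkℚ (+ suc p-1) q-1 coprime) →
    let p = suc p-1 ; q = suc q-1
    in algorithm q p , λ n M₁ M₂ ρ₁ ρ₂ isRank₁ isRank₂ r r-max →
      let indep , approx , few = algorithm-correct q p M₁ M₂ isRank₁ isRank₂ r-max
      in indep , approximation-ℚ p q-1 coprime r ∣ output (algorithm q p n) ρ₁ ρ₂ ∣ approx
       , query-bound-ℚ p q-1 coprime (queries (algorithm q p n) ρ₁ ρ₂) 24 n few
  -- A positive `ε` has a positive numerator, so the remaining patterns are empty.
  (mkℚ (+ zero) _ _) {{()}}
  (mkℚ -[1+ _ ] _ _) {{()}}
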